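{- Let $H_a, H_b$ be distinct graphs in $\{H_2,H_3,H_4\}$. Then every $(2K_2,K_4,H_a,H_b)$-free graph is recolorable.
   Context: All graphs are finite and simple. For graphs $F_1,\dots,F_t$, a graph $G$ is $(F_1,\dots,F_t)$-free if no induced subgraph of $G$ is isomorphic to any $F_j$. $2K_2$ is the disjoint union of two copies of $K_2$, and $K_4$ is the complete graph on four vertices. The graphs $H_2,H_3,H_4$ are each obtained from a $5$-cycle with vertices $1,2,3,4,5$ in cyclic order by adding one new vertex $u$, where (indices modulo $5$), for some fixed $i$: in $H_2$, $u$ is adjacent to exactly $i-1,i+1$; in $H_3$, $u$ is adjacent to exactly $i,i-2,i+2$; in $H_4$, $u$ is adjacent to exactly the four cycle vertices other than $i$. An $\ell$-coloring of $G$ is a map $V(G)\to\{1,\dots,\ell\}$ giving adjacent vertices distinct colors (not all colors need be used); $\chi(G)$ is the least $\ell$ for which an $\ell$-coloring exists. The reconfiguration graph $\mathcal{R}_\ell(G)$ has the $\ell$-colorings of $G$ as vertices, with two colorings adjacent whenever they differ on exactly one vertex of $G$. The graph $G$ is recolorable if $\mathcal{R}_\ell(G)$ is connected for every $\ell>\chi(G)$. -}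

module Defs where

open import Data.Empty using (⊥)
open import Data.Fin using (Fin; zero; suc; toℕ; splitAt; _≟_)
open import Data.Fin.Patterns using (0F; 1F; 2F; 3F; 4F)
open import Data.Fin.Properties using (all?)
open import Data.Fin.Subset using (Subset; _∈_; ⁅_⁆; _∪_; ∁)
open import Data.Fin.Subset.Properties using (_∈?_)
open import Data.List using (List)
open import Data.List.Relation.Unary.All using (All)
open import Data.Nat using (ℕ; suc; _+_; _≤_; _<_; _%_)
import Data.Nat as ℕ
open import Data.Product using (∃; _×_)
open import Data.Sum using (_⊎_; swap)
open import Data.Sum.Relation.Binary.Pointwise
  using (Pointwise; ⊎-symmetric; ⊎-irreflexive; ⊎-decidable; ≡⇒Pointwise-≡)
open import Data.Vec using (Vec; lookup)
open import Function using (id)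
open import Function.Bundles using (_⇔_)
open import Function.Definitions using (Injective)
open import Level using (0ℓ)
open import Relation.Binary.Core using (Rel)
open import Relation.Binary.Construct.Closure.ReflexiveTransitive using (Star)
open import Relation.Binary.Definitions using (Symmetric; Irreflexive; Decidable)
open import Relation.Binary.PropositionalEquality
  using (_≡_; _≢_; refl; sym; cong; ≢-sym)
open import Relation.Nullary using (¬_; no)
open import Relation.Nullary.Decidable using (¬?; _⊎-dec_; from-yes)

-- Finite simple graphs; the vertex set is Fin order.
record Graph : Set₁ where
  field
    order  : ℕ
    Adj    : Rel (Fin order) 0ℓ
    adj?   : Decidable Adj
    symm   : Symmetric Adj
    irrefl : Irreflexive _≡_ Adj

  Vertex : Set
  Vertex = Fin order

open Graph using (Vertex)

-- An isomorphism from F onto the subgraph of G induced by the image of `map`.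
record InducedCopy (F G : Graph) : Set where
  field
    map       : Vertex F → Vertex G
    injective : Injective _≡_ _≡_ map
    adjacency : ∀ u v → Graph.Adj F u v ⇔ Graph.Adj G (map u) (map v)

Free : List Graph → Graph → Set₁
Free Fs G = All (λ F → ¬ InducedCopy F G) Fs

K : ℕ → Graph
K n = record
  { order  = n
  ; Adj    = _≢_
  ; adj?   = λ u v → ¬? (u ≟ v)
  ; symm   = ≢-sym
  ; irrefl = λ u≡v u≢v → u≢v u≡v
  }

-- The first order G vertices carry G, the remaining ones carry H.
_⊎ᴳ_ : Graph → Graph → Graph
G ⊎ᴳ H = record
  { order  = G.order + H.order
  ; Adj    = λ u v → Pointwise G.Adj H.Adj (splitAt G.order u) (splitAt G.order v)
  ; adj?   = λ u v → ⊎-decidable G.adj? H.adj? (splitAt G.order u) (splitAt G.order v)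
  ; symm   = ⊎-symmetric G.symm H.symm
  ; irrefl = λ u≡v → ⊎-irreflexive G.irrefl H.irrefl
                       (≡⇒Pointwise-≡ (cong (splitAt G.order) u≡v))
  }
  where
  module G = Graph G
  module H = Graph H

2K₂ : Graph
2K₂ = K 2 ⊎ᴳ K 2

C₅ : Graph
C₅ = record
  { order  = 5
  ; Adj    = Adj
  ; adj?   = adj?
  ; symm   = swap
  ; irrefl = λ { {u} refl → from-yes (all? λ v → ¬? (adj? v v)) u }
  }
  where
  Adj : Rel (Fin 5) 0ℓ
  Adj u v = (toℕ v ≡ suc (toℕ u) % 5) ⊎ (toℕ u ≡ suc (toℕ v) % 5)

  adj? : Decidable Adj
  adj? u v = (toℕ v ℕ.≟ suc (toℕ u) % 5) ⊎-dec (toℕ u ℕ.≟ suc (toℕ v) % 5)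

-- A new vertex zero with neighbourhood N; the old vertex v becomes suc v.
addVertex : (G : Graph) → Subset (Graph.order G) → Graph
addVertex G N = record
  { order  = suc G.order
  ; Adj    = Adj
  ; adj?   = adj?
  ; symm   = λ {u} {v} → symm u v
  ; irrefl = λ { {u} refl → irrefl u }
  }
  where
  module G = Graph G

  Adj : Rel (Fin (suc G.order)) 0ℓ
  Adj zero    zero    = ⊥
  Adj zero    (suc v) = v ∈ N
  Adj (suc u) zero    = u ∈ N
  Adj (suc u) (suc v) = G.Adj u v

  adj? : Decidable Adj
  adj? zero    zero    = no id
  adj? zero    (suc v) = v ∈? N
  adj? (suc u) zero    = u ∈? N
  adj? (suc u) (suc v) = G.adj? u v

  symm : ∀ u v → Adj u v → Adj v u
  symm zero    (suc v) = id
  symm (suc u) zero    = id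
  symm (suc u) (suc v) = G.symm

  irrefl : ∀ u → ¬ Adj u u
  irrefl (suc u) = G.irrefl refl

data HIndex : Set where
  two three four : HIndex

-- The distinguished cycle vertex i is taken to be 0; by the rotational symmetry
-- of C₅ every other choice gives an isomorphic graph.  The three graphs have
-- 7, 8 and 9 edges, so distinct indices give non-isomorphic graphs.
H : HIndex → Graph
H two   = addVertex C₅ (⁅ 4F ⁆ ∪ ⁅ 1F ⁆)
H three = addVertex C₅ (⁅ 0F ⁆ ∪ ⁅ 3F ⁆ ∪ ⁅ 2F ⁆)
H four  = addVertex C₅ (∁ ⁅ 0F ⁆)

-- A vector of colours together with an irrelevant properness proof, so that
-- colourings with the same colours are propositionally equal; this matters for
-- the reflexive steps of Star below.
record Coloring (G : Graph) (ℓ : ℕ) : Set where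
  constructor coloring
  field
    colors  : Vec (Fin ℓ) (Graph.order G)
    .proper : ∀ u v → Graph.Adj G u v → lookup colors u ≢ lookup colors v

  color : Vertex G → Fin ℓ
  color = lookup colors

open Coloring using (color)

IsChromaticNumber : Graph → ℕ → Set
IsChromaticNumber G χ = Coloring G χ × (∀ m → Coloring G m → χ ≤ m)

-- Adjacency in the reconfiguration graph.
Reconf : (G : Graph) (ℓ : ℕ) → Rel (Coloring G ℓ) 0ℓ
Reconf G ℓ α β = ∃ λ (v : Vertex G) →
  color α v ≢ color β v × (∀ w → w ≢ v → color α w ≡ color β w)

Connected : {A : Set} → Rel A 0ℓ → Set
Connected R = ∀ x y → Star R x y

Recolorable : Graph → Set
Recolorable G = ∀ χ → IsChromaticNumber G χ → ∀ ℓ → χ < ℓ → Connected (Reconf G ℓ)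

{-# OPTIONS --safe #-}

-- If N(u) ⊆ N(v) for two vertices u ≠ v, then colourings of G - u lift to G by
-- giving u the colour of v, so u may be deleted.  A graph of the class without such
-- a pair is one of finitely many graphs, on at most 15 vertices, and in each of these
-- every stable set lies in one class of an optimal colouring.  This settles the
-- theorem by induction on the number k of colours needed: extend the class of colour 0
-- to the class S of 0 in a k-colouring, recolour the rest by induction without using 0,
-- so that the top colour is unused, move S to the top colour, and now recolour towards
-- any given k-colouring, the colour 0 being free.
--
-- The finite list comes from an exhaustive search: while some u is dominated by v in
-- the induced subgraph found so far, there is a further vertex adjacent to u and not
-- to v; otherwise, any further vertex is added.
module Submission where

open import Defs
open import Data.Bool using (Bool; true; false; T; not; _∧_; _∨_; if_then_else_)
import Data.Bool as Bool
open import Data.Bool.ListAction using (all; any)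
open import Data.Bool.Properties using (T?; T-∧; T-∨; T-≡)
open import Data.Empty using (⊥; ⊥-elim; ⊥-elim-irr)
open import Data.Fin using (Fin; zero; suc; toℕ; fromℕ<)
import Data.Fin as Fin
open import Data.Fin.Patterns using (0F; 1F; 2F; 3F)
open import Data.Fin.Properties using (toℕ<n; toℕ-injective; toℕ-fromℕ<)
import Data.Fin.Properties as Fin
open import Data.List using (List; []; _∷_; filter; concatMap; map; length; upTo; allFin; null)
open import Data.List.Membership.Propositional using (_∈_; find; lose)
import Data.List.Membership.DecPropositional as DecMembership
open import Data.List.Membership.Propositional.Properties
  using (∈-filter⁺; ∈-filter⁻; ∈-concatMap⁺; ∈-concatMap⁻; ∈-map⁺; ∈-map⁻;
         ∈-upTo⁺; ∈-upTo⁻; ∈-allFin)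
open import Data.List.Properties using (filter-notAll)
open import Data.List.Relation.Unary.All as All using (All; []; _∷_; all?)
import Data.List.Relation.Unary.All.Properties as All
open import Data.List.Relation.Unary.Any as Any using (here; there; any?)
open import Data.List.Relation.Unary.Any.Properties using (any⁻)
open import Data.Nat
  using (ℕ; zero; suc; _≤_; _<_; z≤n; s≤s; _≡ᵇ_; pred; _/_; _%_; _^_)
open import Data.Nat.DivMod using (_mod_)
open import Data.Nat.Induction using (Acc; acc; <-wellFounded)
open import Data.Nat.Properties
  using (≡ᵇ⇒≡; ≡⇒≡ᵇ; <-≤-trans; <⇒≢; n<1+n; <⇒≤; m<n⇒n≢0; n≮0; ≮⇒≥; m^n≢0)
open import Data.Product using (∃; ∃₂; _×_; _,_; proj₁; proj₂)
open import Data.Sum using (_⊎_; inj₁; inj₂; [_,_]′)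
open import Data.Vec using (Vec; []; _∷_; lookup; tabulate; zipWith)
import Data.Vec as Vec
open import Data.Vec.Properties
  using (lookup∘tabulate; tabulate∘lookup; tabulate-cong; lookup-map; lookup-zipWith)
open import Function using (_∘_; id; case_of_)
open import Function.Bundles using (Equivalence; mk⇔)
open import Relation.Binary.Construct.Closure.ReflexiveTransitive using (Star; ε; _◅_)
open import Relation.Binary.Definitions using (tri<; tri≈; tri>)
open import Relation.Binary.PropositionalEquality
  using (_≡_; _≢_; refl; sym; trans; cong; subst; ≢-sym)
open import Relation.Nullary using (¬_; Dec; yes; no; does)
open import Relation.Nullary.Decidable
  using (¬?; _×-dec_; _→-dec_; dec-true; dec-false; does-⇔; decidable-stable)

-- Recolouring paths in induced subgraphs.

module Recolouring (G : Graph) where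
  open Graph G

  private variable
    U   : List Vertex
    k m : ℕ
    f g h : Vertex → ℕ
    u v w x y : Vertex

  -- A colouring of the subgraph induced by U is a function on all vertices, of which
  -- only the values on U matter.
  record Colours (m : ℕ) (U : List Vertex) (f : Vertex → ℕ) : Set where
    constructor colours
    field
      bounded : x ∈ U → f x < m
      proper  : x ∈ U → y ∈ U → Adj x y → f x ≢ f y

  open Colours

  AgreeOff : List Vertex → Vertex → (f g : Vertex → ℕ) → Set
  AgreeOff U x f g = ∀ {w} → w ∈ U → w ≢ x → f w ≡ g w

  -- A move may leave the colour of `x` as it was; such moves are discarded only in `realize`. Since
  -- values outside `U` are arbitrary, `stop` asks for agreement on `U` alone.
  data Path (m : ℕ) (U : List Vertex) : (f g : Vertex → ℕ) → Set where
    stop : (∀ {x} → x ∈ U → f x ≡ g x) → Path m U f g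
    move : ∀ x → AgreeOff U x f g → Colours m U g → Path m U g h → Path m U f h

  Mixing : ℕ → List Vertex → Set
  Mixing m U = ∀ {f g} → Colours m U f → Colours m U g → Path m U f g

  relabel : (∀ {x} → x ∈ U → f x ≡ g x) → Path m U g h → Path m U f h
  relabel f≗g (stop g≗h)        = stop λ x∈U → trans (f≗g x∈U) (g≗h x∈U)
  relabel f≗g (move x eq c p) = move x (λ w∈U w≢x → trans (f≗g w∈U) (eq w∈U w≢x)) c p

  append : Path m U f g → Path m U g h → Path m U f h
  append (stop f≗g)      q = relabel f≗g q
  append (move x eq c p) q = move x eq c (append p q)

  -- A path certifies every function it moves to but not its start, which becomes the target of the
  -- last reversed move and so has to be certified separately.
  reverse : Colours m U f → Path m U f g → Path m U g f
  reverse cf (stop f≗g)       = stop λ x∈U → sym (f≗g x∈U)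
  reverse cf (move x eq c p) =
    append (reverse c p) (move x (λ w∈U w≢x → sym (eq w∈U w≢x)) cf (stop λ _ → refl))

  weaken : k ≤ m → Colours k U f → Colours m U f
  weaken k≤m c = colours (λ x∈U → <-≤-trans (bounded c x∈U) k≤m) (proper c)

  irreflexive : ¬ Adj x x
  irreflexive = irrefl refl

  -- Deleting a dominated vertex.

  Dominates : List Vertex → Vertex → Vertex → Set
  Dominates U v u = ∀ {w} → w ∈ U → Adj u w → Adj v w

  _∖_ : List Vertex → Vertex → List Vertex
  U ∖ u = filter (λ x → ¬? (x Fin.≟ u)) U

  ∈-∖⁺ : x ∈ U → x ≢ u → x ∈ U ∖ u
  ∈-∖⁺ {u = u} = ∈-filter⁺ (λ x → ¬? (x Fin.≟ u))

  ∈-∖⁻ : x ∈ U ∖ u → x ∈ U × x ≢ u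
  ∈-∖⁻ {u = u} = ∈-filter⁻ (λ x → ¬? (x Fin.≟ u))

  length-∖ : ∀ U → u ∈ U → length (U ∖ u) < length U
  length-∖ {u} U u∈U =
    filter-notAll (λ x → ¬? (x Fin.≟ u)) U (Any.map (λ u≡x x≢u → x≢u (sym u≡x)) u∈U)

  restrict : Colours m U f → Colours m (U ∖ u) f
  restrict c = colours (λ x∈ → bounded c (proj₁ (∈-∖⁻ x∈)))
                       (λ x∈ y∈ → proper c (proj₁ (∈-∖⁻ x∈)) (proj₁ (∈-∖⁻ y∈)))

  module Dominated {U u v} (u∈U : u ∈ U) (v∈U : v ∈ U) (u≢v : u ≢ v)
                   (dom : Dominates U v u) where

    v∈U∖u : v ∈ U ∖ u
    v∈U∖u = ∈-∖⁺ v∈U (≢-sym u≢v)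

    override : ℕ → (Vertex → ℕ) → Vertex → ℕ
    override c f x = if does (x Fin.≟ u) then c else f x

    override-≢ : ∀ {c} → x ≢ u → override c f x ≡ f x
    override-≢ {x} x≢u rewrite dec-false (x Fin.≟ u) x≢u = refl

    -- u is adjacent neither to itself nor to v, so only the other vertices matter.
    override-colours : ∀ {c} → c < m → Colours m (U ∖ u) g →
      (∀ {y} → y ∈ U ∖ u → Adj v y → c ≢ g y) → Colours m U (override c g)
    override-colours {m = m} {g = g} {c} c<m cg clash = colours b p
      where
      b : x ∈ U → override c g x < m
      b {x} x∈U with x Fin.≟ u
      ... | yes _   = c<m
      ... | no x≢u = bounded cg (∈-∖⁺ x∈U x≢u)
      p : x ∈ U → y ∈ U → Adj x y → override c g x ≢ override c g y
      p {x} {y} x∈U y∈U x~y with x Fin.≟ u | y Fin.≟ u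
      ... | yes refl | yes refl = ⊥-elim (irreflexive x~y)
      ... | yes refl | no y≢u  = clash (∈-∖⁺ y∈U y≢u) (dom y∈U x~y)
      ... | no x≢u   | yes refl = ≢-sym (clash (∈-∖⁺ x∈U x≢u) (dom x∈U (symm x~y)))
      ... | no x≢u   | no y≢u  = proper cg (∈-∖⁺ x∈U x≢u) (∈-∖⁺ y∈U y≢u) x~y

    fold : (Vertex → ℕ) → Vertex → ℕ
    fold f = override (f v) f

    fold-colours : Colours m (U ∖ u) f → Colours m U (fold f)
    fold-colours c = override-colours (bounded c v∈U∖u) c (proper c v∈U∖u)

    -- A move of a vertex other than `v` lifts to the same move. A move of `v` lifts to two moves:
    -- first `v`, then `u`, which follows to the new colour.
    fold-path : Colours m (U ∖ u) f → Path m (U ∖ u) f g → Path m U (fold f) (fold g)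
    fold-path {f = f} {g} cf (stop f≗g) = stop eq
      where
      eq : x ∈ U → fold f x ≡ fold g x
      eq {x} x∈U with x Fin.≟ u
      ... | yes _   = f≗g v∈U∖u
      ... | no x≢u = f≗g (∈-∖⁺ x∈U x≢u)
    fold-path {f = f} cf (move {g = g} x eq cg p) with v Fin.≟ x
    ... | no v≢x = move x eq′ (fold-colours cg) (fold-path cg p)
      where
      eq′ : AgreeOff U x (fold f) (fold g)
      eq′ {w} w∈U w≢x with w Fin.≟ u
      ... | yes _   = eq v∈U∖u v≢x
      ... | no w≢u = eq (∈-∖⁺ w∈U w≢u) w≢x
    -- In between, `u` still has the old colour `f v`. This is proper because the neighbours of `v`
    -- differ from `v`, so the move has not changed them, and `f v` was already distinct from their
    -- colours.
    ... | yes refl = move v eq₁ (override-colours (bounded cf v∈U∖u) cg clash)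
                       (move u eq₂ (fold-colours cg) (fold-path cg p))
      where
      clash : y ∈ U ∖ u → Adj v y → f v ≢ g y
      clash {y} y∈ v~y fv≡gy =
        proper cf v∈U∖u y∈ v~y
          (trans fv≡gy (sym (eq y∈ λ { refl → irreflexive v~y })))
      eq₁ : AgreeOff U v (fold f) (override (f v) g)
      eq₁ {w} w∈U w≢v with w Fin.≟ u
      ... | yes _   = refl
      ... | no w≢u = eq (∈-∖⁺ w∈U w≢u) w≢v
      eq₂ : AgreeOff U u (override (f v) g) (fold g)
      eq₂ _ w≢u = trans (override-≢ {f = g} w≢u) (sym (override-≢ {f = g} w≢u))

    -- At the start `u` takes the colour of `v`, then the path of `U ∖ u` is lifted, and at the end
    -- `u` takes its colour in the target.
    mixing : Mixing m (U ∖ u) → Mixing m U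
    mixing conn {f} {g} cf cg =
      move u (λ _ w≢u → sym (override-≢ {f = f} w≢u)) (fold-colours (restrict cf))
        (append (fold-path (restrict cf) (conn (restrict cf) (restrict cg)))
          (move u (λ _ → override-≢ {f = g}) cg (stop λ _ → refl)))

  -- Repainting a stable set, and splitting off the class of colour 0.

  Stable : List Vertex → (Vertex → Bool) → Set
  Stable U S = ∀ {x y} → x ∈ U → y ∈ U → T (S x) → T (S y) → ¬ Adj x y

  paint : (Vertex → Bool) → ℕ → (Vertex → ℕ) → Vertex → ℕ
  paint S c f x = if S x then c else f x

  module _ {U} {S : Vertex → Bool} {c} (stable : Stable U S)
           (c<m : c < m) (cf : Colours m U f) (fresh : ∀ {x} → x ∈ U → ¬ T (S x) → f x ≢ c)
           where

    open DecMembership (Fin._≟_ {order}) using (_∈?_)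

    private
      _∩_ : (Vertex → Bool) → List Vertex → Vertex → Bool
      (R ∩ L) x = R x ∧ does (x ∈? L)

    -- Stated for every part `R` of `S`, so that it covers all stages of painting `S` one vertex at
    -- a time. Some vertices of `S` may have the colour `c` beforehand.
    paint-⊆ : ∀ {R} → (∀ {x} → T (R x) → T (S x)) → Colours m U (paint R c f)
    paint-⊆ {R} R⊆S = colours b p
      where
      b : x ∈ U → paint R c f x < m
      b {x} x∈U with R x
      ... | true  = c<m
      ... | false = bounded cf x∈U
      apart : x ∈ U → y ∈ U → Adj x y → T (S x) → c ≢ f y
      apart {x} {y} x∈U y∈U x~y Sx c≡fy =
        fresh y∈U (λ Sy → stable x∈U y∈U Sx Sy x~y) (sym c≡fy)
      p : x ∈ U → y ∈ U → Adj x y → paint R c f x ≢ paint R c f y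
      p {x} {y} x∈U y∈U x~y with R x in Rx | R y in Ry
      ... | true  | true  = λ _ →
        stable x∈U y∈U (R⊆S (subst T (sym Rx) _)) (R⊆S (subst T (sym Ry) _)) x~y
      ... | true  | false = apart x∈U y∈U x~y (R⊆S (subst T (sym Rx) _))
      ... | false | true  = ≢-sym (apart y∈U x∈U (symm x~y) (R⊆S (subst T (sym Ry) _)))
      ... | false | false = proper cf x∈U y∈U x~y

    paint-path : Path m U f (paint S c f)
    paint-path = append (go U) (stop done)
      where
      go : ∀ L → Path m U f (paint (S ∩ L) c f)
      go []      = stop λ {x} _ → none x
        where
        none : ∀ x → f x ≡ paint (S ∩ []) c f x
        none x with S x
        ... | true  = refl
        ... | false = refl
      -- Adding `y` to the list changes the painting at `y` only, so each list element contributes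
      -- one move.
      go (y ∷ L) = append (go L)
        (move y same (paint-⊆ (λ {x} → proj₁ ∘ Equivalence.to (T-∧ {S x}))) (stop λ _ → refl))
        where
        same : AgreeOff U y (paint (S ∩ L) c f) (paint (S ∩ (y ∷ L)) c f)
        same {w} _ w≢y rewrite dec-false (w Fin.≟ y) w≢y = refl
      done : x ∈ U → paint (S ∩ U) c f x ≡ paint S c f x
      done {x} x∈U rewrite dec-true (x ∈? U) x∈U with S x
      ... | true  = refl
      ... | false = refl

    paint-colours : Colours m U (paint S c f)
    paint-colours = paint-⊆ id

  -- Makes `S` the class of 0 and raises all other colours by one. A path on `U ─ S` with `m`
  -- colours thus becomes a path on `U` with `suc m` colours that never touches `S`.
  shift : (Vertex → Bool) → (Vertex → ℕ) → Vertex → ℕ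
  shift S f = paint S 0 (suc ∘ f)

  _─_ : List Vertex → (Vertex → Bool) → List Vertex
  U ─ S = filter (λ x → ¬? (T? (S x))) U

  ∈-─⁺ : ∀ S → x ∈ U → ¬ T (S x) → x ∈ U ─ S
  ∈-─⁺ S = ∈-filter⁺ (λ x → ¬? (T? (S x)))

  ∈-─⁻ : ∀ S → x ∈ U ─ S → x ∈ U × ¬ T (S x)
  ∈-─⁻ S = ∈-filter⁻ (λ x → ¬? (T? (S x)))

  module _ {U S} (stable : Stable U S) where

    shift-colours : Colours m (U ─ S) f → Colours (suc m) U (shift S f)
    shift-colours {m = m} {f = f} cf = colours b p
      where
      b : x ∈ U → shift S f x < suc m
      b {x} x∈U with S x in Sx
      ... | true  = s≤s z≤n
      ... | false = s≤s (bounded cf (∈-─⁺ S x∈U (subst T Sx)))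
      p : x ∈ U → y ∈ U → Adj x y → shift S f x ≢ shift S f y
      p {x} {y} x∈U y∈U x~y with S x in Sx | S y in Sy
      ... | true  | true  = λ _ →
        stable x∈U y∈U (subst T (sym Sx) _) (subst T (sym Sy) _) x~y
      ... | true  | false = λ ()
      ... | false | true  = λ ()
      ... | false | false = λ eq →
        proper cf (∈-─⁺ S x∈U (subst T Sx)) (∈-─⁺ S y∈U (subst T Sy)) x~y (cong pred eq)

    shift-cong : (∀ {x} → x ∈ U ─ S → f x ≡ g x) → x ∈ U → shift S f x ≡ shift S g x
    shift-cong {x = x} eq x∈U with S x in Sx
    ... | true  = refl
    ... | false = cong suc (eq (∈-─⁺ S x∈U (subst T Sx)))

    shift-path : Path m (U ─ S) f g → Path (suc m) U (shift S f) (shift S g)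
    shift-path (stop f≗g) = stop (shift-cong f≗g)
    shift-path {f = f} (move {g = g} x eq cg p) = move x eq′ (shift-colours cg) (shift-path p)
      where
      eq′ : AgreeOff U x (shift S f) (shift S g)
      eq′ {w} w∈U w≢x with S w in Sw
      ... | true  = refl
      ... | false = cong suc (eq (∈-─⁺ S w∈U (subst T Sw)) w≢x)

  zeros : (Vertex → ℕ) → Vertex → Bool
  zeros f x = f x ≡ᵇ 0

  zeros-stable : Colours m U f → Stable U (zeros f)
  zeros-stable {f = f} cf {x} {y} x∈U y∈U fx≡0 fy≡0 x~y =
    proper cf x∈U y∈U x~y (trans (≡ᵇ⇒≡ (f x) 0 fx≡0) (sym (≡ᵇ⇒≡ (f y) 0 fy≡0)))

  -- Puts a given colouring with zero class `S` into the form to which `shift-path` applies.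
  shift-pred : ∀ S f → (x ∈ U → T (S x) → f x ≡ 0) → (x ∈ U → ¬ T (S x) → f x ≢ 0) →
    x ∈ U → f x ≡ shift S (pred ∘ f) x
  shift-pred {x = x} S f on off x∈U with S x | f x
  ... | true  | _     = on x∈U _
  ... | false | zero  = ⊥-elim (off x∈U id refl)
  ... | false | suc _ = refl

  pred-colours : ∀ {S} → Colours (suc m) U f → (∀ {x} → x ∈ U → ¬ T (S x) → f x ≢ 0) →
    Colours m (U ─ S) (pred ∘ f)
  pred-colours {m = m} {U = U} {f = f} {S} cf off = colours b p
    where
    b : x ∈ U ─ S → pred (f x) < m
    b {x} x∈ with x∈U , ¬S ← ∈-─⁻ S x∈ with f x | bounded cf x∈U | off x∈U ¬S
    ... | zero  | _       | 0≢0 = ⊥-elim (0≢0 refl)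
    ... | suc _ | s≤s <m | _   = <m
    p : x ∈ U ─ S → y ∈ U ─ S → Adj x y → pred (f x) ≢ pred (f y)
    p {x} {y} x∈ y∈ x~y with x∈U , ¬Sx ← ∈-─⁻ S x∈ | y∈U , ¬Sy ← ∈-─⁻ S y∈
      with f x | f y | off x∈U ¬Sx | off y∈U ¬Sy | proper cf x∈U y∈U x~y
    ... | zero  | _     | 0≢0 | _   | _ = ⊥-elim (0≢0 refl)
    ... | suc _ | zero  | _   | 0≢0 | _ = ⊥-elim (0≢0 refl)
    ... | suc _ | suc _ | _   | _   | ≢ = λ eq → ≢ (cong suc eq)

  -- The induction step for sets whose stable sets extend to colour classes.

  Colourable : ℕ → List Vertex → Set
  Colourable k U = ∃ (Colours k U)

  -- Here `suc k` is any number of colours that suffices, not just the least. The colour 0 can stand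
  -- for any class, as colours may be permuted.
  Extendable : List Vertex → Set
  Extendable U = ∀ k → Colourable (suc k) U → ∀ S → Stable U S →
    ∃ λ h → Colours (suc k) U h × (∀ {x} → x ∈ U → T (S x) → h x ≡ 0)

  module _ (IH : ∀ {U} → Colourable k U → Mixing m U) (k≤m : k ≤ m) where

    -- First the zero class of f is enlarged to that of h; the remaining vertices
    -- are then recoloured by induction, without the colour 0.
    absorb : Colours (suc m) U f → Colours (suc k) U h →
      (∀ {x} → x ∈ U → f x ≡ 0 → h x ≡ 0) → Path (suc m) U f h
    absorb {U = U} {f = f} {h = h} cf ch f₀⊆h₀ =
      append (paint-path stable (s≤s z≤n) cf fresh)
        (relabel (shift-pred S (paint S 0 f) on off)
          (append (shift-path stable
                    -- Off its class of 0, `h` uses only `k` colours, so the induction hypothesis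
                    -- applies to `U ─ S`.
                    (IH (_ , ck) (pred-colours {S = S} painted off) (weaken k≤m ck)))
            (stop λ x∈U → sym (shift-pred S h (λ _ → ≡ᵇ⇒≡ _ 0) off-h x∈U))))
      where
      S       = zeros h
      stable  = zeros-stable ch
      off-h : x ∈ U → ¬ T (S x) → h x ≢ 0
      off-h _ ¬0 h≡0 = ¬0 (≡⇒≡ᵇ _ 0 h≡0)
      ck      = pred-colours {S = S} ch off-h
      fresh : x ∈ U → ¬ T (S x) → f x ≢ 0
      fresh x∈U ¬0 f≡0 = ¬0 (≡⇒≡ᵇ _ 0 (f₀⊆h₀ x∈U f≡0))
      painted = paint-colours stable (s≤s z≤n) cf fresh
      on : x ∈ U → T (S x) → paint S 0 f x ≡ 0
      on {x} _ Sx with S x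
      ... | true = refl
      off : x ∈ U → ¬ T (S x) → paint S 0 f x ≢ 0
      off {x} x∈U ¬Sx with S x in Sx
      ... | true  = ⊥-elim (¬Sx _)
      ... | false = fresh x∈U (subst T Sx)

  module _ (IH : ∀ {U} → Colourable k U → Mixing m U) (k<m : k < m) (ext : Extendable U) where

    -- After absorbing f into a (k+1)-colouring, the top colour m is unused and
    -- takes over the class of 0; so h can be absorbed next.
    towards : Colours (suc m) U f → Colours (suc k) U h → Path (suc m) U f h
    towards {f = f} {h = h} cf ch
      with h′ , ch′ , f₀⊆h′₀ ← ext _ (h , ch) (zeros f) (zeros-stable cf) =
      append (absorb IH (<⇒≤ k<m) cf ch′ (λ x∈U f≡0 → f₀⊆h′₀ x∈U (≡⇒≡ᵇ _ 0 f≡0)))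
        (append (paint-path stable (n<1+n m) ch″ fresh)
          (absorb IH (<⇒≤ k<m) (paint-colours stable (n<1+n m) ch″ fresh) ch no-zero))
      where
      stable = zeros-stable ch′
      ch″    = weaken (s≤s (<⇒≤ k<m)) ch′
      fresh : x ∈ U → ¬ T (zeros h′ x) → h′ x ≢ m
      fresh x∈U _ = <⇒≢ (<-≤-trans (bounded ch′ x∈U) k<m)
      -- The condition of `absorb` holds vacuously: the former class of 0 now has the colour `m`,
      -- which is positive, so no vertex has colour 0.
      no-zero : x ∈ U → paint (zeros h′) m h′ x ≡ 0 → h x ≡ 0
      no-zero {x} _ eq with h′ x
      ... | zero = ⊥-elim (m<n⇒n≢0 k<m eq)

    mixing-step : Colourable (suc k) U → Mixing (suc m) U
    -- Both colourings are led to the same colouring `h` with `suc k` colours.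
    mixing-step (h , ch) cf cg = append (towards cf ch) (reverse cg (towards cg ch))

  -- Reduction to irreducible sets, and the induction on the number of colours.

  Irreducible : List Vertex → Set
  Irreducible U = ∀ {u v} → u ∈ U → v ∈ U → u ≢ v → ∃ λ w → w ∈ U × Adj u w × ¬ Adj v w

  Reduction : List Vertex → Set
  Reduction U = ∃₂ λ u v → u ∈ U × v ∈ U × u ≢ v × Dominates U v u

  module _ (U : List Vertex) where
    private
      Dom : Vertex → Vertex → Set
      Dom u v = u ≢ v × All (λ w → Adj u w → Adj v w) U

      dom? : ∀ u v → Dec (Dom u v)
      dom? u v = ¬? (u Fin.≟ v) ×-dec all? (λ w → adj? u w →-dec adj? v w) U

    reduce? : Reduction U ⊎ Irreducible U
    reduce? with any? (λ u → any? (dom? u) U) U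
    ... | yes found = inj₁ (let u , u∈U , p = find found; v , v∈U , u≢v , dom = find p in
                        u , v , u∈U , v∈U , u≢v , λ w∈U → All.lookup dom w∈U)
    ... | no none = inj₂ λ {u} {v} u∈U v∈U u≢v →
          case any? (λ w → adj? u w ×-dec ¬? (adj? v w)) U of λ where
            (yes p) → find p
            (no ¬p) → ⊥-elim (none (lose u∈U (lose v∈U (u≢v , All.tabulate λ {w} w∈U u~w →
                        case adj? v w of λ where
                          (yes v~w) → v~w
                          (no v≁w)  → ⊥-elim (¬p (lose w∈U (u~w , v≁w)))))))

  -- Dominated vertices are deleted one at a time, with both numbers of colours fixed, until none is
  -- left; `Dominated.mixing` then brings them back.
  reduce : (∀ U → Irreducible U → Colourable k U → Mixing m U) →
    ∀ U → Acc _<_ (length U) → Colourable k U → Mixing m U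
  reduce irreducible U (acc rec) (h , ch) with reduce? U
  ... | inj₁ (u , v , u∈U , v∈U , u≢v , dom) = Dominated.mixing u∈U v∈U u≢v dom
          (reduce irreducible (U ∖ u) (rec (length-∖ U u∈U)) (h , restrict ch))
  ... | inj₂ irr = irreducible U irr (h , ch)

  module _ (classify : ∀ U → Irreducible U → Extendable U) where

    -- The induction is over all `U` at once: removing a colour class from an irreducible set need
    -- not leave an irreducible one, so the reduction starts afresh for each `k`.
    mixing : ∀ k m → k < m → ∀ U → Colourable k U → Mixing m U
    mixing zero    m       _         U (h , ch) _ _ =
      stop λ x∈U → ⊥-elim (n≮0 (bounded ch x∈U))
    mixing (suc k) (suc m) (s≤s k<m) U = reduce
      (λ U irr → mixing-step (λ {U} → mixing k m k<m U) k<m (classify U irr))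
      U (<-wellFounded _)

    -- From paths to walks in the reconfiguration graph.

    private variable ℓ : ℕ

    everything : List Vertex
    everything = allFin order

    colours-of : (α : Coloring G ℓ) → Colours ℓ everything (toℕ ∘ Coloring.color α)
    colours-of (coloring c p) = colours (λ {x} _ → toℕ<n (lookup c x))
      λ {x} {y} _ _ x~y eq → ⊥-elim-irr (p x y x~y (toℕ-injective eq))

    lookup-injective : ∀ {n} (c d : Vec (Fin ℓ) n) → (∀ x → lookup c x ≡ lookup d x) → c ≡ d
    lookup-injective c d eq =
      trans (sym (tabulate∘lookup c)) (trans (tabulate-cong eq) (tabulate∘lookup d))

    coloring-≡ : {α β : Coloring G ℓ} → (∀ x → Coloring.color α x ≡ Coloring.color β x) → α ≡ β
    coloring-≡ {α = coloring c p} {coloring d q} eq with refl ← lookup-injective c d eq = refl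

    to-coloring : Colours ℓ everything f → 
      ∃ λ (α : Coloring G ℓ) → ∀ x → toℕ (Coloring.color α x) ≡ f x
    to-coloring {ℓ} {f} c = coloring (tabulate col) prop , col-≡
      where
      col : Vertex → Fin ℓ
      col x = fromℕ< (bounded c (∈-allFin x))
      col-≡ : ∀ x → toℕ (lookup (tabulate col) x) ≡ f x
      col-≡ x = trans (cong toℕ (lookup∘tabulate col x)) (toℕ-fromℕ< _)
      prop : ∀ x y → Adj x y → lookup (tabulate col) x ≢ lookup (tabulate col) y
      prop x y x~y eq = proper c (∈-allFin x) (∈-allFin y) x~y
        (trans (sym (col-≡ x)) (trans (cong toℕ eq) (col-≡ y)))

    realize : (α β : Coloring G ℓ) → Path ℓ everything f g →
      (∀ x → toℕ (Coloring.color α x) ≡ f x) → (∀ x → toℕ (Coloring.color β x) ≡ g x) →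
      Star (Reconf G ℓ) α β
    realize α β (stop f≗g) α≗f β≗g with refl ← coloring-≡ {α = α} {β}
      (λ x → toℕ-injective (trans (α≗f x) (trans (f≗g (∈-allFin x)) (sym (β≗g x))))) = ε
    realize α β (move x eq c p) α≗f β≗g with γ , γ≗ ← to-coloring c
      with agree ← (λ w w≢x → toℕ-injective
        (trans (α≗f w) (trans (eq (∈-allFin w) w≢x) (sym (γ≗ w)))))
      with Coloring.color α x Fin.≟ Coloring.color γ x
    ... | no α≢γ = (x , α≢γ , agree) ◅ realize γ β p γ≗ β≗g
    -- A move that keeps the colour of `x` is no edge of `Reconf`; it is dropped by identifying its
    -- two ends.
    ... | yes α≡γ with refl ← coloring-≡ {α = α} {γ} (λ w → case w Fin.≟ x of λ where
                                  (yes refl) → α≡γ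
                                  (no w≢x)   → agree w w≢x) = realize γ β p γ≗ β≗g

    recolorable : Recolorable G
    recolorable χ (α , _) ℓ χ<ℓ β γ =
      realize β γ
        (mixing χ ℓ χ<ℓ everything (_ , colours-of α) (colours-of β) (colours-of γ))
        (λ _ → refl) (λ _ → refl)

-- Patterns: finite graphs for computation, with their colourings and stable sets.

private variable
  A : Set
  n m : ℕ

-- The newest vertex is zero; its row lists the adjacencies to the older ones.
data Pattern : ℕ → Set where
  []  : Pattern 0
  _∷_ : Vec Bool n → Pattern n → Pattern (suc n)

edge : Pattern n → Fin n → Fin n → Bool
edge (r ∷ p) zero    zero    = false
edge (r ∷ p) zero    (suc j) = lookup r j
edge (r ∷ p) (suc i) zero    = lookup r i
edge (r ∷ p) (suc i) (suc j) = edge p i j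

allᵇ : (Fin n → Bool) → Bool
allᵇ f = all f (allFin _)

T-∧⁻ : ∀ {x y} → T (x ∧ y) → T x × T y
T-∧⁻ = Equivalence.to T-∧

allᵇ⁻ : (f : Fin n → Bool) → T (allᵇ f) → ∀ i → T (f i)
allᵇ⁻ f t i = All.lookup (All.all⁺ f _ t) (∈-allFin i)

T-not⁻ : ∀ {x} → T (not x) → ¬ T x
T-not⁻ {false} _ ()

T-not⁺ : ∀ {x} → ¬ T x → T (not x)
T-not⁺ {false} _ = _
T-not⁺ {true} ¬t = ¬t _

_⇒ᵇ_ : Bool → Bool → Bool
x ⇒ᵇ y = not x ∨ y

⇒ᵇ⁻ : ∀ {x y} → T (x ⇒ᵇ y) → T x → T y
⇒ᵇ⁻ {true} t _ = t

-- Enumerates the labellings without a clash along an edge. Labels are either colours, clashing when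
-- equal, or Booleans, clashing when both true; the latter labellings are the stable sets.
module Assignments (C : List A) (clash : A → A → Bool) where

  compatible : Vec Bool n → A → Vec A n → Bool
  compatible []          x []       = true
  compatible (true ∷ r)  x (y ∷ ys) = not (clash x y) ∧ compatible r x ys
  compatible (false ∷ r) x (y ∷ ys) = compatible r x ys

  assignments : Pattern n → List (Vec A n)
  assignments []      = [] ∷ []
  assignments (r ∷ p) =
    concatMap (λ ys → map (_∷ ys) (filter (λ x → T? (compatible r x ys)) C)) (assignments p)

  compatible⁺ : ∀ (r : Vec Bool n) x f → (∀ i → T (lookup r i) → ¬ T (clash x (f i))) →
    T (compatible r x (tabulate f))
  compatible⁺ []          x f ok = _
  compatible⁺ (true ∷ r)  x f ok =
    Equivalence.from T-∧ (T-not⁺ (ok zero _) , compatible⁺ r x (f ∘ suc) (ok ∘ suc))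
  compatible⁺ (false ∷ r) x f ok = compatible⁺ r x (f ∘ suc) (ok ∘ suc)

  compatible⁻ : ∀ (r : Vec Bool n) x ys → T (compatible r x ys) →
    ∀ i → T (lookup r i) → ¬ T (clash x (lookup ys i))
  compatible⁻ (true ∷ r)  x (y ∷ ys) t zero    _ = T-not⁻ (proj₁ (T-∧⁻ t))
  compatible⁻ (true ∷ r)  x (y ∷ ys) t (suc i)   =
    compatible⁻ r x ys (proj₂ (T-∧⁻ {not (clash x y)} t)) i
  compatible⁻ (false ∷ r) x (y ∷ ys) t (suc i)   = compatible⁻ r x ys t i

  assignments⁺ : ∀ (p : Pattern n) f → (∀ i → f i ∈ C) →
    (∀ i j → T (edge p i j) → ¬ T (clash (f i) (f j))) → tabulate f ∈ assignments p
  assignments⁺ []      f f∈C ok = here refl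
  assignments⁺ (r ∷ p) f f∈C ok = ∈-concatMap⁺ _
    (lose (assignments⁺ p (f ∘ suc) (f∈C ∘ suc) (λ i j → ok (suc i) (suc j)))
      (∈-map⁺ _ (∈-filter⁺ _ (f∈C zero)
        (compatible⁺ r (f zero) (f ∘ suc) (λ i → ok zero (suc i))))))

  module _ (clash-sym : ∀ {x y} → T (clash x y) → T (clash y x)) where

    assignments⁻ : ∀ (p : Pattern n) {ys} → ys ∈ assignments p →
      (∀ i → lookup ys i ∈ C) × (∀ i j → T (edge p i j) → ¬ T (clash (lookup ys i) (lookup ys j)))
    assignments⁻ [] _ = (λ ()) , λ ()
    assignments⁻ (r ∷ p) ys∈
      with zs , zs∈ , ys∈′ ← find (∈-concatMap⁻ _ {xs = assignments p} ys∈)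
      with x , x∈ , refl ← ∈-map⁻ (_∷ zs) ys∈′
      with x∈C , ok ← ∈-filter⁻ (λ x → T? (compatible r x zs)) {xs = C} x∈
      with in-C , proper ← assignments⁻ p zs∈ =
      (λ { zero → x∈C ; (suc i) → in-C i }) , λ where
        zero    (suc j) → compatible⁻ r x zs ok j
        -- `compatible` tests an edge from its newer end only.
        (suc i) zero    → λ e c → compatible⁻ r x zs ok i e (clash-sym c)
        (suc i) (suc j) → proper i j

open Assignments using (assignments; assignments⁺; assignments⁻)

colorings : ℕ → Pattern n → List (Vec ℕ n)
colorings k = assignments (upTo k) _≡ᵇ_

bools : List Bool
bools = false ∷ true ∷ []

stableSets : Pattern n → List (Vec Bool n)
stableSets = assignments bools _∧_

colorsZero : Vec Bool n → Vec ℕ n → Bool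
colorsZero []          []       = true
colorsZero (true ∷ s)  (x ∷ xs) = (x ≡ᵇ 0) ∧ colorsZero s xs
colorsZero (false ∷ s) (x ∷ xs) = colorsZero s xs

colorsZero⁻ : ∀ (s : Vec Bool n) xs → T (colorsZero s xs) → ∀ i → T (lookup s i) → lookup xs i ≡ 0
colorsZero⁻ (true ∷ s)  (x ∷ xs) t zero    _ = ≡ᵇ⇒≡ x 0 (proj₁ (T-∧⁻ t))
colorsZero⁻ (true ∷ s)  (x ∷ xs) t (suc i)   = colorsZero⁻ s xs (proj₂ (T-∧⁻ {x ≡ᵇ 0} t)) i
colorsZero⁻ (false ∷ s) (x ∷ xs) t (suc i)   = colorsZero⁻ s xs t i

-- If k + 1 colours are necessary for p, it suffices to extend stable sets to classes
-- of colourings with exactly k + 1 colours.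
extendable : ℕ → Pattern n → Bool
extendable k p =
  all (λ s → any (colorsZero s) (colorings (suc k) p)) (stableSets p) ∧
  ((k ≡ᵇ 0) ∨ null (colorings k p))

-- Possible adjacencies of a further vertex.

meets : Vec Bool n → Vec Bool n → Bool
meets []       []       = false
meets (x ∷ xs) (y ∷ ys) = (x ∧ y) ∨ meets xs ys

hasEdge : Pattern n → Vec Bool n → Bool
hasEdge []      []       = false
hasEdge (r ∷ p) (x ∷ xs) = (x ∧ meets r xs) ∨ hasEdge p xs

-- Looks for nonadjacent pairs of distinct vertices; this is exhaustive for the disjoint sets
-- `t ∖ᵇ r` and `r ∖ᵇ t` to which it is applied.
hasGap : Pattern n → Vec Bool n → Vec Bool n → Bool
hasGap []      []       []       = false
hasGap (r ∷ p) (x ∷ xs) (y ∷ ys) =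
  (x ∧ meets (Vec.map not r) ys) ∨ ((y ∧ meets (Vec.map not r) xs) ∨ hasGap p xs ys)

_∩_ _∖ᵇ_ : Vec Bool n → Vec Bool n → Vec Bool n
_∩_  = zipWith _∧_
_∖ᵇ_ = zipWith λ x y → x ∧ not y

outside : Vec Bool n → Vec Bool n → Vec Bool n
outside = zipWith λ x y → not x ∧ not y

-- Let x be the newest vertex of r ∷ p, and w a further one whose adjacencies to x
-- and p are b and t.  No 2K₂ and no K₄ of p, x, w may contain both x and w.
admissible : Pattern n → Vec Bool n → Bool → Vec Bool n → Bool
admissible p r true  t = not (hasEdge p (t ∩ r)) ∧ not (hasEdge p (outside t r))
admissible p r false t = not (hasGap p (t ∖ᵇ r) (r ∖ᵇ t))

-- Rows grow from the oldest vertex on, so a 2K₂ or K₄ through the further vertex is detected as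
-- soon as the newest of its other vertices is reached.
rows : Pattern n → List (Vec Bool n)
rows []      = [] ∷ []
rows (r ∷ p) = concatMap (λ t → map (_∷ t)
  (filter (λ b → T? (admissible p r b t)) bools)) (rows p)

meets⁻ : ∀ (xs ys : Vec Bool n) → T (meets xs ys) → ∃ λ i → T (lookup xs i) × T (lookup ys i)
meets⁻ []           []          ()
meets⁻ (true ∷ xs)  (true ∷ ys) _ = zero , _ , _
meets⁻ (true ∷ xs)  (false ∷ ys) t with i , p ← meets⁻ xs ys t = suc i , p
meets⁻ (false ∷ xs) (y ∷ ys) t with i , p ← meets⁻ xs ys t = suc i , p

hasEdge⁻ : ∀ (p : Pattern n) xs → T (hasEdge p xs) →
  ∃₂ λ i j → T (lookup xs i) × T (lookup xs j) × T (edge p i j)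
hasEdge⁻ [] [] ()
hasEdge⁻ (r ∷ p) (x ∷ xs) t with Equivalence.to (T-∨ {x ∧ meets r xs}) t
... | inj₁ t₁ with Tx , m ← T-∧⁻ {x} t₁ with j , rj , xj ← meets⁻ r xs m =
      zero , suc j , Tx , xj , rj
... | inj₂ t₂ with i , j , e ← hasEdge⁻ p xs t₂ = suc i , suc j , e

hasGap⁻ : ∀ (p : Pattern n) xs ys → T (hasGap p xs ys) →
  ∃₂ λ i j → T (lookup xs i) × T (lookup ys j) × ¬ T (edge p i j)
hasGap⁻ [] [] [] ()
hasGap⁻ (r ∷ p) (x ∷ xs) (y ∷ ys) t with Equivalence.to (T-∨ {x ∧ meets (Vec.map not r) ys}) t
... | inj₁ t₁ with Tx , m ← T-∧⁻ {x} t₁ with j , rj , yj ← meets⁻ (Vec.map not r) ys m =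
      zero , suc j , Tx , yj , T-not⁻ (subst T (lookup-map j not r) rj)
... | inj₂ t₂ with Equivalence.to (T-∨ {y ∧ meets (Vec.map not r) xs}) t₂
...   | inj₁ t₃ with Ty , m ← T-∧⁻ {y} t₃ with i , ri , xi ← meets⁻ (Vec.map not r) xs m =
        suc i , zero , xi , Ty , T-not⁻ (subst T (lookup-map i not r) ri)
...   | inj₂ t₃ with i , j , e ← hasGap⁻ p xs ys t₃ = suc i , suc j , e

-- Encoding and checking of the search.

bits : ∀ n → ℕ → Vec Bool n
bits zero    x = []
bits (suc n) x = (x % 2 ≡ᵇ 1) ∷ bits n (x / 2)

-- The least significant bit of a row belongs to the most recent of the older vertices.
decode : (rs : List ℕ) → Pattern (length rs)
decode []       = []
decode (r ∷ rs) = bits (length rs) r ∷ decode rs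

-- Base 16 suffices, since patterns have at most 15 vertices and 16 after extension. The digits are
-- not trusted: `isCopy` tests the resulting map.
digit : ∀ n → ℕ → ℕ → Fin (suc n)
digit n x i = ((x / (16 ^ i)) {{m^n≢0 16 i}} % 16) mod suc n

-- An entry is a pattern, given by the binary codes of its rows, in which either vertex u
-- is dominated by v, or no vertex is dominated and k + 1 is the chromatic number.
-- It has one child for each possible row of a further vertex: a position in the list of
-- earlier patterns, and the hexadecimal code of an embedding into the pattern so extended.
data Branching : Set where
  dominated   : (u v : ℕ) → Branching
  irreducible : (k : ℕ) → Branching

infix 6 _↦_
data Reference : Set where
  _↦_ : (target embedding : ℕ) → Reference

record Entry : Set where
  constructor entry
  field
    newest    : ℕ
    older     : List ℕ
    branching : Branching
    children  : List Reference

  size : ℕ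
  size = length older

  shape : Pattern (suc size)
  shape = decode (newest ∷ older)

open Entry

Environment : Set
Environment = List (∃ Pattern)

isCopy : Pattern m → Pattern n → (Fin m → Fin n) → Bool
isCopy p q τ = allᵇ λ i → allᵇ λ j →
  does (edge p i j Bool.≟ edge q (τ i) (τ j)) ∧ (does (τ i Fin.≟ τ j) ⇒ᵇ does (i Fin.≟ j))

-- Position 0 is the entry just before; the patterns resolved at the outset come last.
refersTo : Environment → Pattern (suc n) → Reference → Bool
refersTo []              q (_ ↦ _)           = false
refersTo ((m , p) ∷ env) q (zero ↦ code)     = isCopy p q (λ i → digit _ code (toℕ i))
refersTo (_ ∷ env)       q (suc k ↦ code)    = refersTo env q (k ↦ code)

covered : Environment → Pattern n → List (Vec Bool n) → List Reference → Bool
covered env p []       _        = true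
covered env p (_ ∷ _)  []       = false
covered env p (r ∷ rs) (c ∷ cs) = refersTo env (r ∷ p) c ∧ covered env p rs cs

dominates : Pattern n → Fin n → Fin n → Bool
dominates p j i = allᵇ λ k → edge p i k ⇒ᵇ edge p j k

separating : Pattern n → Fin n → Fin n → List (Vec Bool n)
separating p i j = filter (λ r → T? (lookup r i ∧ not (lookup r j))) (rows p)

resolves : Environment → Pattern n → Fin n → Fin n → List Reference → Bool
resolves env p i j cs =
  not (does (i Fin.≟ j)) ∧ (dominates p j i ∧ covered env p (separating p i j) cs)

verify : Environment → Entry → Bool
verify env e with branching e
... | dominated u v = resolves env (shape e) (u mod suc (size e)) (v mod suc (size e)) (children e)
... | irreducible k = extendable k (shape e) ∧ covered env (shape e) (rows (shape e)) (children e)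

extend : Environment → List Entry → Environment
extend env []       = env
extend env (e ∷ es) = extend ((_ , shape e) ∷ env) es

-- An entry may refer to earlier ones only, so the list runs from the leaves of the search to its
-- root.
verifyAll : Environment → List Entry → Bool
verifyAll env []       = true
verifyAll env (e ∷ es) = verify env e ∧ verifyAll ((_ , shape e) ∷ env) es

T-does⁻ : (a? : Dec A) → T (does a?) → A
T-does⁻ (yes a) _ = a

T-does⁺ : (a? : Dec A) → A → T (does a?)
T-does⁺ (yes _) _ = _
T-does⁺ (no ¬a) a = ¬a a

T-not-does⁻ : (a? : Dec A) → T (not (does a?)) → ¬ A
T-not-does⁻ a? t a = T-not⁻ t (T-does⁺ a? a)

dominates⁻ : ∀ (p : Pattern n) {i j} → T (dominates p j i) → ∀ k → T (edge p i k) → T (edge p j k)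
dominates⁻ p t k = ⇒ᵇ⁻ (allᵇ⁻ _ t k)

-- Graphs as patterns, induced copies, and the forbidden four-vertex graphs.

∈-bools : ∀ b → b ∈ bools
∈-bools false = here refl
∈-bools true  = there (here refl)

toPattern : (Fin n → Fin n → Bool) → Pattern n
toPattern {zero}  b = []
toPattern {suc n} b = tabulate (λ j → b zero (suc j)) ∷ toPattern (λ i j → b (suc i) (suc j))

edge-toPattern : (b : Fin n → Fin n → Bool) → (∀ i → b i i ≡ false) → (∀ i j → b i j ≡ b j i) →
  ∀ i j → edge (toPattern b) i j ≡ b i j
edge-toPattern b irr sy zero    zero    = sym (irr zero)
edge-toPattern b irr sy zero    (suc j) = lookup∘tabulate _ j
edge-toPattern b irr sy (suc i) zero    = trans (lookup∘tabulate _ i) (sy zero (suc i))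
edge-toPattern b irr sy (suc i) (suc j) =
  edge-toPattern _ (irr ∘ suc) (λ i j → sy (suc i) (suc j)) i j

module _ (F : Graph) where
  open Graph F

  adjᵇ : Vertex → Vertex → Bool
  adjᵇ u v = does (adj? u v)

  adjᵇ-irrefl : ∀ u → adjᵇ u u ≡ false
  adjᵇ-irrefl u = dec-false (adj? u u) (irrefl refl)

  adjᵇ-sym : ∀ u v → adjᵇ u v ≡ adjᵇ v u
  adjᵇ-sym u v = does-⇔ (mk⇔ symm symm) (adj? u v) (adj? v u)

  patternOf : Pattern order
  patternOf = toPattern adjᵇ

  edge-patternOf : ∀ u v → edge patternOf u v ≡ adjᵇ u v
  edge-patternOf = edge-toPattern adjᵇ adjᵇ-irrefl adjᵇ-sym

module _ (F G : Graph) where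
  private
    module F = Graph F
    module G = Graph G

  inducedCopy : (f : F.Vertex → G.Vertex) → (∀ {u v} → f u ≡ f v → u ≡ v) →
    (∀ u v → adjᵇ F u v ≡ adjᵇ G (f u) (f v)) → InducedCopy F G
  inducedCopy f inj same = record
    { map       = f
    ; injective = inj
    ; adjacency = λ u v → mk⇔
        (λ a → T-does⁻ (G.adj? _ _) (subst T (same u v) (T-does⁺ (F.adj? u v) a)))
        (λ a → T-does⁻ (F.adj? u v) (subst T (sym (same u v)) (T-does⁺ (G.adj? _ _) a)))
    }

module FourVertices (G : Graph) where
  open Graph G

  -- Leaves only the pairs with `i < j` to compare, six of them for four vertices.
  symmetrically : ∀ {n} (b : Fin n → Fin n → Bool) (f : Fin n → Vertex) →
    (∀ i → b i i ≡ false) → (∀ i j → b i j ≡ b j i) →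
    (∀ {i j} → i Fin.< j → b i j ≡ adjᵇ G (f i) (f j)) → ∀ i j → b i j ≡ adjᵇ G (f i) (f j)
  symmetrically b f irr sy eq i j with Fin.<-cmp i j
  ... | tri< i<j _ _    = eq i<j
  ... | tri≈ _ refl _   = trans (irr i) (sym (adjᵇ-irrefl G (f i)))
  ... | tri> _ _ j<i    = trans (sy i j) (trans (eq j<i) (adjᵇ-sym G (f j) (f i)))

  injectively : ∀ {n} (f : Fin n → Vertex) → (∀ {i j} → i Fin.< j → f i ≢ f j) →
    ∀ {i j} → f i ≡ f j → i ≡ j
  injectively f apart {i} {j} eq with Fin.<-cmp i j
  ... | tri< i<j _ _    = ⊥-elim (apart i<j eq)
  ... | tri≈ _ i≡j _    = i≡j
  ... | tri> _ _ j<i    = ⊥-elim (apart j<i (sym eq))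

  adjacent⇒≢ : ∀ {u v} → Adj u v → u ≢ v
  adjacent⇒≢ u~v refl = irrefl refl u~v

  private variable a b c d : Vertex

  module _ (¬2K₂ : ¬ InducedCopy 2K₂ G) where
    no2K₂ : Adj a b → Adj c d → ¬ Adj a c → ¬ Adj a d → ¬ Adj b c → ¬ Adj b d → ⊥
    no2K₂ {a} {b} {c} {d} ab cd ac ad bc bd = ¬2K₂ (inducedCopy 2K₂ G f
      (injectively f apart)
      (symmetrically (adjᵇ 2K₂) f (adjᵇ-irrefl 2K₂) (adjᵇ-sym 2K₂) same))
      where
      f : Fin 4 → Vertex
      f = lookup (a ∷ b ∷ c ∷ d ∷ [])
      apart : ∀ {i j} → i Fin.< j → f i ≢ f j
      apart {0F} {1F} _ = adjacent⇒≢ ab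
      -- Ends of different edges are distinct: if `a` were `c`, the edge `cd` would join `a` to `d`.
      apart {0F} {2F} _ = λ { refl → ad cd }
      apart {0F} {3F} _ = λ { refl → ac (symm cd) }
      apart {1F} {2F} _ = λ { refl → bd cd }
      apart {1F} {3F} _ = λ { refl → bc (symm cd) }
      apart {2F} {3F} _ = adjacent⇒≢ cd
      apart {suc _} {1F} (s≤s ())
      apart {2F} {2F} (s≤s (s≤s ()))
      apart {3F} {2F} (s≤s (s≤s ()))
      apart {3F} {3F} (s≤s (s≤s (s≤s ())))
      same : ∀ {i j} → i Fin.< j → adjᵇ 2K₂ i j ≡ adjᵇ G (f i) (f j)
      same {0F} {1F} _ = sym (dec-true  (adj? a b) ab)
      same {0F} {2F} _ = sym (dec-false (adj? a c) ac)
      same {0F} {3F} _ = sym (dec-false (adj? a d) ad)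
      same {1F} {2F} _ = sym (dec-false (adj? b c) bc)
      same {1F} {3F} _ = sym (dec-false (adj? b d) bd)
      same {2F} {3F} _ = sym (dec-true  (adj? c d) cd)
      same {suc _} {1F} (s≤s ())
      same {2F} {2F} (s≤s (s≤s ()))
      same {3F} {2F} (s≤s (s≤s ()))
      same {3F} {3F} (s≤s (s≤s (s≤s ())))

  module _ (¬K₄ : ¬ InducedCopy (K 4) G) where
    noK₄ : Adj a b → Adj a c → Adj a d → Adj b c → Adj b d → Adj c d → ⊥
    noK₄ {a} {b} {c} {d} ab ac ad bc bd cd = ¬K₄ (inducedCopy (K 4) G f
      (injectively f (adjacent⇒≢ ∘ complete))
      (symmetrically (adjᵇ (K 4)) f (adjᵇ-irrefl (K 4)) (adjᵇ-sym (K 4))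
        λ {i} {j} i<j → trans (dec-true (Graph.adj? (K 4) i j) (Fin.<⇒≢ i<j)) (sym (dec-true (adj? _ _) (complete i<j)))))
      where
      f : Fin 4 → Vertex
      f = lookup (a ∷ b ∷ c ∷ d ∷ [])
      complete : ∀ {i j} → i Fin.< j → Adj (f i) (f j)
      complete {0F} {1F} _ = ab
      complete {0F} {2F} _ = ac
      complete {0F} {3F} _ = ad
      complete {1F} {2F} _ = bc
      complete {1F} {3F} _ = bd
      complete {2F} {3F} _ = cd
      complete {suc _} {1F} (s≤s ())
      complete {2F} {2F} (s≤s (s≤s ()))
      complete {3F} {2F} (s≤s (s≤s ()))
      complete {3F} {3F} (s≤s (s≤s (s≤s ())))

-- Soundness of the search inside an irreducible set.

module Soundness (G : Graph) (¬2K₂ : ¬ InducedCopy 2K₂ G) (¬K₄ : ¬ InducedCopy (K 4) G)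
                 (U : List (Graph.Vertex G)) (irr : Recolouring.Irreducible G U) where
  open Graph G
  open Recolouring G hiding (_─_)
  open FourVertices G

  record Embedding (p : Pattern n) : Set where
    field
      at        : Fin n → Vertex
      at-∈      : ∀ i → at i ∈ U
      injective : ∀ {i j} → at i ≡ at j → i ≡ j
      edges     : ∀ i j → edge p i j ≡ adjᵇ G (at i) (at j)

    covers? : ∀ w → Dec (∃ λ i → at i ≡ w)
    covers? w = Fin.any? λ i → at i Fin.≟ w

    row : Vertex → Vec Bool n
    row w = tabulate λ i → adjᵇ G w (at i)

    lookup-row : ∀ w i → lookup (row w) i ≡ adjᵇ G w (at i)
    lookup-row w = lookup∘tabulate _

    adjacent : ∀ {i j} → T (edge p i j) → Adj (at i) (at j)
    adjacent {i} {j} t = T-does⁻ (adj? _ _) (subst T (edges i j) t)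

    edge⁺ : ∀ {i j} → Adj (at i) (at j) → T (edge p i j)
    edge⁺ {i} {j} a = subst T (sym (edges i j)) (T-does⁺ (adj? _ _) a)

  open Embedding

  -- The conclusion concerns `U` and not the embedding, so it passes from the children of an entry
  -- to the entry. Forbidden patterns are resolved vacuously.
  Resolved : ∃ Pattern → Set
  Resolved (_ , p) = Embedding p → Extendable U

  add : ∀ {p : Pattern n} (e : Embedding p) {w} → w ∈ U → ¬ (∃ λ i → at e i ≡ w) →
    Embedding (row e w ∷ p)
  add e {w} w∈U new = record
    { at        = λ { zero → w ; (suc i) → at e i }
    ; at-∈      = λ { zero → w∈U ; (suc i) → at-∈ e i }
    ; injective = λ { {zero} {zero} _ → refl ; {zero} {suc j} eq → ⊥-elim (new (j , sym eq))
                    ; {suc i} {zero} eq → ⊥-elim (new (i , eq))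
                    ; {suc i} {suc j} eq → cong suc (injective e eq) }
    ; edges     = λ { zero zero → sym (adjᵇ-irrefl G w)
                    ; zero (suc j) → lookup-row e w j
                    ; (suc i) zero → trans (lookup-row e w i) (adjᵇ-sym G w (at e i))
                    ; (suc i) (suc j) → edges e i j }
    }

  forget : ∀ {r} {p : Pattern n} → Embedding (r ∷ p) → Embedding p
  forget e = record
    { at        = at e ∘ suc
    ; at-∈      = at-∈ e ∘ suc
    ; injective = Fin.suc-injective ∘ injective e
    ; edges     = λ i j → edges e (suc i) (suc j)
    }

  module _ {r} {p : Pattern n} (e : Embedding (r ∷ p)) (w : Vertex) where
    private
      x = at e zero
      f = at e ∘ suc
      t = row (forget e) w

      w-on : ∀ i → T (lookup t i) → Adj w (f i)
      w-on i = T-does⁻ (adj? w (f i)) ∘ subst T (lookup-row (forget e) w i)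
      w-off : ∀ i → T (not (lookup t i)) → ¬ Adj w (f i)
      w-off i = T-not-does⁻ (adj? w (f i)) ∘ subst (T ∘ not) (lookup-row (forget e) w i)
      x-on : ∀ i → T (lookup r i) → Adj x (f i)
      x-on i = T-does⁻ (adj? x (f i)) ∘ subst T (edges e zero (suc i))
      x-off : ∀ i → T (not (lookup r i)) → ¬ Adj x (f i)
      x-off i = T-not-does⁻ (adj? x (f i)) ∘ subst (T ∘ not) (edges e zero (suc i))

      split : ∀ (φ ψ : Bool → Bool) s s′ i → T (lookup (zipWith (λ x y → φ x ∧ ψ y) s s′) i) →
        T (φ (lookup {n = n} s i)) × T (ψ (lookup s′ i))
      split φ ψ s s′ i = T-∧⁻ ∘ subst T (lookup-zipWith _ i s s′)

    admissible⁺ : T (admissible p r (adjᵇ G w x) t)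
    admissible⁺ with adj? w x
    -- An edge between common neighbours of `w` and `x` would complete a K₄, and one between common
    -- non-neighbours a 2K₂.
    ... | yes w~x = Equivalence.from T-∧ (T-not⁺ triangle , T-not⁺ separate)
      where
      triangle : ¬ T (hasEdge p (t ∩ r))
      triangle h with i , j , ti , tj , eij ← hasEdge⁻ p _ h
        with wi , xi ← split id id t r i ti | wj , xj ← split id id t r j tj =
        noK₄ ¬K₄ w~x (w-on i wi) (w-on j wj) (x-on i xi) (x-on j xj) (adjacent (forget e) eij)
      separate : ¬ T (hasEdge p (outside t r))
      separate h with i , j , ti , tj , eij ← hasEdge⁻ p _ h
        with wi , xi ← split not not t r i ti | wj , xj ← split not not t r j tj =
        no2K₂ ¬2K₂ w~x (adjacent (forget e) eij) (w-off i wi) (w-off j wj) (x-off i xi) (x-off j xj)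
    -- A private neighbour of `w` and a private neighbour of `x` that are not adjacent would give a
    -- 2K₂ with `w` and `x`.
    ... | no w≁x = T-not⁺ crossing
      where
      crossing : ¬ T (hasGap p (t ∖ᵇ r) (r ∖ᵇ t))
      crossing h with i , j , ti , tj , ¬eij ← hasGap⁻ p _ _ h
        with wi , xi ← split id not t r i ti | xj , wj ← split id not r t j tj =
        no2K₂ ¬2K₂ (w-on i wi) (x-on j xj) w≁x (w-off j wj) (x-off i xi ∘ symm)
          (¬eij ∘ edge⁺ (forget e))

  row∈rows : ∀ {p : Pattern n} (e : Embedding p) w → row e w ∈ rows p
  row∈rows {p = []}    e w = here refl
  row∈rows {p = r ∷ p} e w = ∈-concatMap⁺ _ (lose (row∈rows (forget e) w)
    (∈-map⁺ _ (∈-filter⁺ (λ b → T? (admissible p r b _)) (∈-bools _) (admissible⁺ e w))))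

  restrictTo : ∀ {p : Pattern m} {q : Pattern n} τ → T (isCopy p q τ) → Embedding q → Embedding p
  restrictTo {p = p} {q} τ copy e = record
    { at        = at e ∘ τ
    ; at-∈      = at-∈ e ∘ τ
    ; injective = λ {i} {j} eq → T-does⁻ (i Fin.≟ j)
        (⇒ᵇ⁻ (proj₂ (T-∧⁻ {does (edge p i j Bool.≟ _)} (pair i j)))
          (T-does⁺ (τ i Fin.≟ τ j) (injective e eq)))
    ; edges     = λ i j → trans (T-does⁻ (_ Bool.≟ _) (proj₁ (T-∧⁻ (pair i j)))) (edges e (τ i) (τ j))
    }
    where
    pair : ∀ i j → T (does (edge p i j Bool.≟ edge q (τ i) (τ j)) ∧
                        (does (τ i Fin.≟ τ j) ⇒ᵇ does (i Fin.≟ j)))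
    pair i = allᵇ⁻ _ (allᵇ⁻ _ copy i)

  refersTo-sound : ∀ env (q : Pattern (suc n)) c → All Resolved env → T (refersTo env q c) → Resolved (_ , q)
  refersTo-sound (_ ∷ _)   q (zero ↦ code)  (done ∷ _) t e = done (restrictTo _ t e)
  refersTo-sound (_ ∷ env) q (suc k ↦ code) (_ ∷ done) t e = refersTo-sound env q (k ↦ code) done t e

  covered-sound : ∀ env (p : Pattern n) {rs} cs → All Resolved env → T (covered env p rs cs) →
    ∀ {r} → r ∈ rs → Resolved (_ , r ∷ p)
  covered-sound env p (c ∷ cs) done t (here refl) =
    refersTo-sound env (_ ∷ p) c done (proj₁ (T-∧⁻ t))
  covered-sound env p {r ∷ _} (c ∷ cs) done t (there r∈) =
    covered-sound env p cs done (proj₂ (T-∧⁻ {refersTo env (r ∷ p) c} t)) r∈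

  module _ {p : Pattern n} (e : Embedding p) (onto : ∀ {w} → w ∈ U → ∃ λ i → at e i ≡ w) where

    colouring∈ : ∀ {k h} → Colours k U h → tabulate (h ∘ at e) ∈ colorings k p
    colouring∈ {k} {h} c = assignments⁺ (upTo k) _≡ᵇ_ p (h ∘ at e)
      (λ i → ∈-upTo⁺ (bounded c (at-∈ e i)))
      (λ i j a same → proper c (at-∈ e i) (at-∈ e j) (adjacent e a) (≡ᵇ⇒≡ _ _ same))
      where open Colours

    transport : ∀ {k ys} → ys ∈ colorings k p →
      ∃ λ h → Colours k U h × (∀ i → h (at e i) ≡ lookup ys i)
    transport {k} {ys} ys∈ with in-C , ok ← assignments⁻ (upTo k) _≡ᵇ_
        (λ {x} {y} x≡y → ≡⇒≡ᵇ y x (sym (≡ᵇ⇒≡ x y x≡y))) p ys∈ = h , colours b pr , h-at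
      where
      h : Vertex → ℕ
      h w with covers? e w
      ... | yes (i , _) = lookup ys i
      -- An arbitrary value: since the embedding is onto `U`, such a `w` lies outside `U`.
      ... | no _        = 0
      h-at : ∀ i → h (at e i) ≡ lookup ys i
      h-at i with covers? e (at e i)
      ... | yes (j , eq) = cong (lookup ys) (injective e eq)
      ... | no ¬c        = ⊥-elim (¬c (i , refl))
      b : ∀ {w} → w ∈ U → h w < k
      b w∈U with i , refl ← onto w∈U = subst (_< k) (sym (h-at i)) (∈-upTo⁻ (in-C i))
      pr : ∀ {v w} → v ∈ U → w ∈ U → Adj v w → h v ≢ h w
      pr v∈U w∈U v~w eq with i , refl ← onto v∈U | j , refl ← onto w∈U =
        ok i j (edge⁺ e v~w) (≡⇒≡ᵇ _ _ (trans (sym (h-at i)) (trans eq (h-at j))))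

    -- The check provides colourings with `suc k` colours, whereas any sufficient `suc k′` may be
    -- asked for. As `k` is 0 or too few colours for `p`, `k ≤ k′`, and the colouring found may be
    -- weakened.
    extendable-sound : ∀ k → T (extendable k p) → Extendable U
    extendable-sound k t k′ (h , ch) S stable
      with t₁ , t₂ ← T-∧⁻ {all _ (stableSets p)} t
      with S∈ ← assignments⁺ bools _∧_ p (S ∘ at e) (λ i → ∈-bools (S (at e i)))
             (λ i j a both → let Si , Sj = T-∧⁻ both in
               stable (at-∈ e i) (at-∈ e j) Si Sj (adjacent e a))
      with ys , ys∈ , zeroed ← find (any⁻ _ _ (All.lookup (All.all⁺ _ _ t₁) S∈))
      with h′ , ch′ , h′-at ← transport ys∈ =
      h′ , weaken (s≤s k≤k′) ch′ , λ w∈U Sw → vanish (onto w∈U) Sw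
      where
      vanish : ∀ {w} → (∃ λ i → at e i ≡ w) → T (S w) → h′ w ≡ 0
      vanish (i , refl) Sw = trans (h′-at i) (colorsZero⁻ (tabulate (S ∘ at e)) ys zeroed i
        (subst T (sym (lookup∘tabulate (S ∘ at e) i)) Sw))
      nonempty : ∀ {A : Set} {x : A} {xs} → x ∈ xs → ¬ T (null xs)
      nonempty (here _)  ()
      nonempty (there _) ()
      k≤k′ : k ≤ k′
      k≤k′ with Equivalence.to (T-∨ {k ≡ᵇ 0}) t₂
      ... | inj₁ k≡0 = subst (_≤ k′) (sym (≡ᵇ⇒≡ k 0 k≡0)) z≤n
      ... | inj₂ none = ≮⇒≥ λ k′<k → nonempty (colouring∈ (weaken k′<k ch)) none

  -- As `U` is irreducible, some `w` in it is adjacent to the image of `i` and not to that of `j`.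
  -- Within the pattern `j` dominates `i`, so `w` is new, and its row is one of those covered.
  resolves-sound : ∀ env (p : Pattern n) i j cs → All Resolved env →
    T (resolves env p i j cs) → Resolved (_ , p)
  resolves-sound env p i j cs done t e
    with i≢j , t′ ← T-∧⁻ {not (does (i Fin.≟ j))} t
    with dom , cov ← T-∧⁻ {dominates p j i} t′
    with w , w∈U , i~w , j≁w ← irr (at-∈ e i) (at-∈ e j) (T-not-does⁻ (i Fin.≟ j) i≢j ∘ injective e)
    with covers? e w
  ... | yes (k , refl) = ⊥-elim (j≁w (adjacent e (dominates⁻ p {i} {j} dom k (edge⁺ e i~w))))
  ... | no new = covered-sound env p cs done cov
      (∈-filter⁺ _ (row∈rows e w)
        (Equivalence.from T-∧
          ( subst T (sym (lookup-row e w i)) (T-does⁺ (adj? _ _) (symm i~w))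
          , subst (T ∘ not) (sym (lookup-row e w j))
              (T-not⁺ λ a → j≁w (symm (T-does⁻ (adj? _ _) a))))))
      (add e w∈U new)

  verify-sound : ∀ env en → All Resolved env → T (verify env en) → Resolved (_ , Entry.shape en)
  verify-sound env en@(entry _ _ (dominated u v) cs) done =
    resolves-sound env (Entry.shape en) (u mod _) (v mod _) cs done
  verify-sound env en@(entry _ _ (irreducible k) cs) done t e
    with t₁ , t₂ ← T-∧⁻ {extendable k (Entry.shape en)} t
    -- Either the embedding misses a vertex of `U`, whose row leads to a child, or the pattern is
    -- all of the graph induced by `U` and the check of its stable sets applies.
    with Any.any? (λ w → ¬? (covers? e w)) U
  ... | yes found = let w , w∈U , new = find found in
        covered-sound env _ cs done t₂ (row∈rows e w) (add e w∈U new)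
  ... | no none = extendable-sound e
        (λ {w} w∈U → decidable-stable (covers? e w) λ ¬c → none (lose w∈U ¬c)) k t₁

  verifyAll-sound : ∀ env es → All Resolved env → T (verifyAll env es) → All Resolved (extend env es)
  verifyAll-sound env []        done t = done
  verifyAll-sound env (en ∷ es) done t with t₁ , t₂ ← T-∧⁻ {verify env en} t =
    verifyAll-sound _ es (verify-sound env en done t₁ ∷ done) t₂

  free-resolved : ∀ F → ¬ InducedCopy F G → Resolved (_ , patternOf F)
  free-resolved F ¬F e = ⊥-elim (¬F (inducedCopy F G (at e) (injective e)
    λ u v → trans (sym (edge-patternOf F u v)) (edges e u v)))

  singleton : ∀ {u} → u ∈ U → Embedding (decode (0 ∷ []))
  singleton {u} u∈U = record
    { at        = λ _ → u
    ; at-∈      = λ _ → u∈U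
    ; injective = λ { {zero} {zero} _ → refl }
    ; edges     = λ { zero zero → sym (adjᵇ-irrefl G u) }
    }

-- The data of the search.

others : HIndex → List HIndex
others two   = three ∷ four ∷ []
others three = two ∷ four ∷ []
others four  = two ∷ three ∷ []

-- The argument names the one graph among H₂, H₃, H₄ that may occur. The root of the search, its
-- last entry, is the 5-cycle.
withC₅ : HIndex → List Entry
withC₅ four =
  entry 31 (0 ∷ 9 ∷ 1 ∷ 1 ∷ 1 ∷ 0 ∷ []) (dominated 1 5)
    (1 ↦ 0x673450 ∷ 1 ↦ 0x761205 ∷ 1 ↦ 0x761205 ∷ []) ∷
  entry 0 (9 ∷ 1 ∷ 1 ∷ 1 ∷ 0 ∷ []) (dominated 0 5)
    (2 ↦ 0x623450 ∷ 2 ↦ 0x654320 ∷ 0 ↦ 0x6543210 ∷ []) ∷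
  entry 46 (15 ∷ 9 ∷ 1 ∷ 1 ∷ 1 ∷ 0 ∷ []) (irreducible 3)
    (0 ↦ 0x765430 ∷ 3 ↦ 0x762015 ∷ 3 ↦ 0x765032 ∷ 2 ↦ 0x567340 ∷ 2 ↦ 0x654370 ∷ 3 ↦ 0x762410 ∷
    3 ↦ 0x734062 ∷ 2 ↦ 0x673450 ∷ 3 ↦ 0x734560 ∷ 3 ↦ 0x765430 ∷ 2 ↦ 0x671420 ∷ 3 ↦ 0x654071 ∷
    2 ↦ 0x765430 ∷ 2 ↦ 0x734560 ∷ 3 ↦ 0x671420 ∷ 3 ↦ 0x673450 ∷ 3 ↦ 0x654370 ∷ 2 ↦ 0x762410 ∷
    3 ↦ 0x567340 ∷ 3 ↦ 0x267140 ∷ []) ∷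
  entry 62 (15 ∷ 9 ∷ 1 ∷ 1 ∷ 1 ∷ 0 ∷ []) (dominated 1 0)
    (4 ↦ 0x517023 ∷ 4 ↦ 0x417026 ∷ 4 ↦ 0x673450 ∷ 4 ↦ 0x567340 ∷ []) ∷
  entry 15 (9 ∷ 1 ∷ 1 ∷ 1 ∷ 0 ∷ []) (dominated 5 0)
    (5 ↦ 0x543260 ∷ 1 ↦ 0x6543210 ∷ 1 ↦ 0x6234510 ∷ 0 ↦ 0x6543210 ∷ []) ∷
  entry 62 (31 ∷ 9 ∷ 1 ∷ 1 ∷ 1 ∷ 0 ∷ []) (dominated 1 0)
    (3 ↦ 0x765430 ∷ 5 ↦ 0x567340 ∷ 5 ↦ 0x654370 ∷ 5 ↦ 0x673450 ∷ 5 ↦ 0x765430 ∷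
    5 ↦ 0x734560 ∷ []) ∷
  -- The wheel with five spokes.
  entry 31 (9 ∷ 1 ∷ 1 ∷ 1 ∷ 0 ∷ []) (irreducible 3)
    (4 ↦ 0x654320 ∷ 4 ↦ 0x654320 ∷ 6 ↦ 0x456230 ∷ 6 ↦ 0x456230 ∷ 6 ↦ 0x543260 ∷ 6 ↦ 0x543260 ∷
    6 ↦ 0x562340 ∷ 6 ↦ 0x562340 ∷ 7 ↦ 0x623450 ∷ 7 ↦ 0x654320 ∷ 2 ↦ 0x6543201 ∷ 6 ↦ 0x654320 ∷
    6 ↦ 0x654320 ∷ 6 ↦ 0x623450 ∷ 6 ↦ 0x623450 ∷ 7 ↦ 0x562340 ∷ 7 ↦ 0x543260 ∷ 2 ↦ 0x5623401 ∷
    7 ↦ 0x456230 ∷ 2 ↦ 0x4562301 ∷ 2 ↦ 0x3456201 ∷ 2 ↦ 0x2654301 ∷ 0 ↦ 0x6543210 ∷ []) ∷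
  -- The 5-cycle. Its 17 rows are the empty one, the full one, and the five rotations of each of the
  -- neighbourhoods in H₂, H₃ and H₄.
  entry 9 (1 ∷ 1 ∷ 1 ∷ 0 ∷ []) (irreducible 2)
    (5 ↦ 0x543210 ∷ 7 ↦ 0x345120 ∷ 7 ↦ 0x432150 ∷ 7 ↦ 0x451230 ∷ 8 ↦ 0x512340 ∷ 8 ↦ 0x543210 ∷
    2 ↦ 0x543210 ∷ 7 ↦ 0x543210 ∷ 7 ↦ 0x512340 ∷ 8 ↦ 0x451230 ∷ 8 ↦ 0x432150 ∷ 2 ↦ 0x451230 ∷
    8 ↦ 0x345120 ∷ 2 ↦ 0x345120 ∷ 2 ↦ 0x234510 ∷ 2 ↦ 0x154320 ∷ 0 ↦ 0x543210 ∷ []) ∷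
  []

withC₅ three =
  entry 0 (853 ∷ 217 ∷ 182 ∷ 87 ∷ 23 ∷ 0 ∷ 9 ∷ 1 ∷ 1 ∷ 1 ∷ 0 ∷ []) (dominated 0 11) [] ∷
  entry 2016 (853 ∷ 217 ∷ 182 ∷ 87 ∷ 23 ∷ 0 ∷ 9 ∷ 1 ∷ 1 ∷ 1 ∷ 0 ∷ []) (irreducible 3)
    (0 ↦ 0xcba987654320 ∷ 1 ↦ 0x69a370 ∷ 1 ↦ 0xabc890 ∷ 1 ↦ 0xba98c0 ∷ 1 ↦ 0xbc89a0 ∷
    1 ↦ 0x9a3760 ∷ 1 ↦ 0xbc5730 ∷ 1 ↦ 0xcba980 ∷ 1 ↦ 0xc89ab0 ∷ 1 ↦ 0xcb3750 ∷ 1 ↦ 0xab2740 ∷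
    1 ↦ 0xc86720 ∷ 1 ↦ 0xc56910 ∷ []) ∷
  entry 853 (217 ∷ 182 ∷ 87 ∷ 23 ∷ 0 ∷ 9 ∷ 1 ∷ 1 ∷ 1 ∷ 0 ∷ []) (irreducible 3)
    (1 ↦ 0xba9876543210 ∷ 2 ↦ 0x589260 ∷ 2 ↦ 0x9ab780 ∷ 2 ↦ 0xa987b0 ∷ 2 ↦ 0xab7890 ∷
    2 ↦ 0x892650 ∷ 2 ↦ 0xab4620 ∷ 2 ↦ 0xba9870 ∷ 2 ↦ 0xb789a0 ∷ 2 ↦ 0xba2640 ∷ 2 ↦ 0x9a1630 ∷
    2 ↦ 0xb75610 ∷ 0 ↦ 0xba9876543210 ∷ []) ∷
  entry 217 (182 ∷ 87 ∷ 23 ∷ 0 ∷ 9 ∷ 1 ∷ 1 ∷ 1 ∷ 0 ∷ []) (dominated 9 3)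
    (0 ↦ 0xa9876543210 ∷ 0 ↦ 0xa9153746280 ∷ []) ∷
  entry 0 (504 ∷ 182 ∷ 87 ∷ 23 ∷ 0 ∷ 9 ∷ 1 ∷ 1 ∷ 1 ∷ 0 ∷ []) (dominated 0 10) [] ∷
  entry 504 (182 ∷ 87 ∷ 23 ∷ 0 ∷ 9 ∷ 1 ∷ 1 ∷ 1 ∷ 0 ∷ []) (irreducible 3)
    (0 ↦ 0xa9876543210 ∷ 6 ↦ 0x367204 ∷ 6 ↦ 0x43a106 ∷ 5 ↦ 0x367250 ∷ 5 ↦ 0x89a670 ∷
    5 ↦ 0x9876a0 ∷ 5 ↦ 0x9a6780 ∷ 6 ↦ 0x367250 ∷ 5 ↦ 0x71a340 ∷ 2 ↦ 0xa9053746281 ∷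
    6 ↦ 0xa60823 ∷ 5 ↦ 0xa98760 ∷ 6 ↦ 0xa67801 ∷ 5 ↦ 0xa67890 ∷ 6 ↦ 0xa08762 ∷ 5 ↦ 0xa17430 ∷
    5 ↦ 0x816420 ∷ 6 ↦ 0xa67890 ∷ 2 ↦ 0x9825063a471 ∷ 6 ↦ 0xa07832 ∷ 5 ↦ 0xa34710 ∷ []) ∷
  entry 182 (87 ∷ 23 ∷ 0 ∷ 9 ∷ 1 ∷ 1 ∷ 1 ∷ 0 ∷ []) (dominated 7 1)
    (2 ↦ 0x9876543210 ∷ 7 ↦ 0x906721 ∷ 0 ↦ 0x9876543210 ∷ []) ∷
  entry 87 (23 ∷ 0 ∷ 9 ∷ 1 ∷ 1 ∷ 1 ∷ 0 ∷ []) (dominated 2 3)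
    (0 ↦ 0x876543210 ∷ 0 ↦ 0x765483102 ∷ []) ∷
  entry 23 (0 ∷ 9 ∷ 1 ∷ 1 ∷ 1 ∷ 0 ∷ []) (dominated 1 5)
    (0 ↦ 0x76543210 ∷ 0 ↦ 0x56734210 ∷ 9 ↦ 0x734560 ∷ []) ∷
  entry 0 (9 ∷ 1 ∷ 1 ∷ 1 ∷ 0 ∷ []) (dominated 0 5)
    (0 ↦ 0x6543210 ∷ 0 ↦ 0x6234510 ∷ 10 ↦ 0x543260 ∷ []) ∷
  entry 13670 (5862 ∷ 2790 ∷ 854 ∷ 359 ∷ 362 ∷ 174 ∷ 53 ∷ 52 ∷ 11 ∷ 9 ∷ 1 ∷ 1 ∷ 1 ∷ 0 ∷ []) (irreducible 3)
    (0 ↦ 0xfedcb0 ∷ 11 ↦ 0xde5b08 ∷ 11 ↦ 0xd2ab0c ∷ 10 ↦ 0xed0bfa ∷ 11 ↦ 0xd6fb03 ∷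
    10 ↦ 0xfb0de2 ∷ 10 ↦ 0xdefbc0 ∷ 11 ↦ 0xe93b0f ∷ 11 ↦ 0xe1cb0a ∷ 10 ↦ 0xedcbf0 ∷
    11 ↦ 0xed7b04 ∷ 10 ↦ 0xedcbf0 ∷ 10 ↦ 0xedcbf0 ∷ 11 ↦ 0xe8bc05 ∷ 11 ↦ 0xe46c0d ∷
    11 ↦ 0xef2c09 ∷ 10 ↦ 0xfe0cb6 ∷ 10 ↦ 0xefbcd0 ∷ 10 ↦ 0xefbcd0 ∷ 10 ↦ 0x860791 ∷
    10 ↦ 0x7986a0 ∷ 10 ↦ 0x314250 ∷ 10 ↦ 0x97a680 ∷ 10 ↦ 0x97a680 ∷ 10 ↦ 0x253140 ∷
    11 ↦ 0xfeac01 ∷ 11 ↦ 0xf75c0b ∷ 11 ↦ 0xf3dc06 ∷ 10 ↦ 0xfedcb0 ∷ 10 ↦ 0xfedcb0 ∷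
    10 ↦ 0xfedcb0 ∷ 11 ↦ 0xf9cd02 ∷ 11 ↦ 0xfb4d07 ∷ 11 ↦ 0xf18d0e ∷ 10 ↦ 0xfbcde0 ∷
    10 ↦ 0xfbcde0 ∷ 10 ↦ 0xfbcde0 ∷ 10 ↦ 0xa68970 ∷ 10 ↦ 0xa68970 ∷ 10 ↦ 0x524130 ∷
    10 ↦ 0xa79860 ∷ 10 ↦ 0xa79860 ∷ 10 ↦ 0x531420 ∷ 10 ↦ 0xa70862 ∷ 10 ↦ 0x86a790 ∷
    10 ↦ 0x425310 ∷ []) ∷
  entry 5862 (2790 ∷ 854 ∷ 359 ∷ 362 ∷ 174 ∷ 53 ∷ 52 ∷ 11 ∷ 9 ∷ 1 ∷ 1 ∷ 1 ∷ 0 ∷ []) (dominated 12 0)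
    (12 ↦ 0xde1b08 ∷ 11 ↦ 0x960751 ∷ 0 ↦ 0xedcba9876543210 ∷ []) ∷
  entry 2790 (854 ∷ 359 ∷ 362 ∷ 174 ∷ 53 ∷ 52 ∷ 11 ∷ 9 ∷ 1 ∷ 1 ∷ 1 ∷ 0 ∷ []) (dominated 9 0)
    (13 ↦ 0xd1ba04 ∷ 12 ↦ 0x857640 ∷ 0 ↦ 0xdcba9876543210 ∷ []) ∷
  entry 854 (359 ∷ 362 ∷ 174 ∷ 53 ∷ 52 ∷ 11 ∷ 9 ∷ 1 ∷ 1 ∷ 1 ∷ 0 ∷ []) (dominated 11 0)
    (14 ↦ 0xc81a04 ∷ 13 ↦ 0x735640 ∷ 0 ↦ 0xcba9876543210 ∷ []) ∷
  entry 359 (362 ∷ 174 ∷ 53 ∷ 52 ∷ 11 ∷ 9 ∷ 1 ∷ 1 ∷ 1 ∷ 0 ∷ []) (dominated 8 0)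
    (15 ↦ 0x9a1704 ∷ 14 ↦ 0x536240 ∷ 0 ↦ 0xba9876543210 ∷ []) ∷
  entry 362 (174 ∷ 53 ∷ 52 ∷ 11 ∷ 9 ∷ 1 ∷ 1 ∷ 1 ∷ 0 ∷ []) (irreducible 3)
    (5 ↦ 0xa98760 ∷ 12 ↦ 0xa9876052134 ∷ 15 ↦ 0x9806a5 ∷ 15 ↦ 0xa60891 ∷ 15 ↦ 0x89a670 ∷
    15 ↦ 0x9876a0 ∷ 15 ↦ 0x9876a0 ∷ 15 ↦ 0x9876a0 ∷ 15 ↦ 0x9a6780 ∷ 15 ↦ 0xa90761 ∷
    15 ↦ 0x9a6780 ∷ 15 ↦ 0x243150 ∷ 0 ↦ 0xa9876543210 ∷ 0 ↦ 0x89a67534120 ∷ 15 ↦ 0x425130 ∷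
    0 ↦ 0x76a98352140 ∷ 0 ↦ 0xa6789325410 ∷ 15 ↦ 0xa98760 ∷ 15 ↦ 0xa98760 ∷ 15 ↦ 0xa98760 ∷
    15 ↦ 0xa67890 ∷ 15 ↦ 0xa67890 ∷ 15 ↦ 0xa67890 ∷ 15 ↦ 0x513420 ∷ 0 ↦ 0x9876a231450 ∷
    0 ↦ 0x789a6213540 ∷ 15 ↦ 0x524310 ∷ 0 ↦ 0x9a678142350 ∷ 0 ↦ 0x6a987124530 ∷ 15 ↦ 0x315240 ∷
    0 ↦ 0x6789a451230 ∷ 0 ↦ 0x876a9415320 ∷ 12 ↦ 0x524310879a6 ∷ []) ∷
  entry 2801 (1708 ∷ 732 ∷ 363 ∷ 174 ∷ 53 ∷ 52 ∷ 11 ∷ 9 ∷ 1 ∷ 1 ∷ 1 ∷ 0 ∷ []) (dominated 11 0)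
    (17 ↦ 0xcb1906 ∷ 4 ↦ 0xa9dcb081476532 ∷ []) ∷
  entry 1708 (732 ∷ 363 ∷ 174 ∷ 53 ∷ 52 ∷ 11 ∷ 9 ∷ 1 ∷ 1 ∷ 1 ∷ 0 ∷ []) (dominated 7 2)
    (18 ↦ 0xa3c804 ∷ 4 ↦ 0xba98c05367421 ∷ 0 ↦ 0xcba9876543210 ∷ []) ∷
  entry 732 (363 ∷ 174 ∷ 53 ∷ 52 ∷ 11 ∷ 9 ∷ 1 ∷ 1 ∷ 1 ∷ 0 ∷ []) (dominated 9 0)
    (19 ↦ 0xab1805 ∷ 4 ↦ 0x789ab0613452 ∷ 0 ↦ 0xba9876543210 ∷ []) ∷
  entry 363 (174 ∷ 53 ∷ 52 ∷ 11 ∷ 9 ∷ 1 ∷ 1 ∷ 1 ∷ 0 ∷ []) (dominated 6 1)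
    (20 ↦ 0xa28701 ∷ 4 ↦ 0x9a678042351 ∷ 0 ↦ 0xa9876543210 ∷ []) ∷
  entry 174 (53 ∷ 52 ∷ 11 ∷ 9 ∷ 1 ∷ 1 ∷ 1 ∷ 0 ∷ []) (dominated 6 2)
    (20 ↦ 0x956780 ∷ 21 ↦ 0x709561 ∷ 4 ↦ 0x9876543210 ∷ 0 ↦ 0x9876543210 ∷
    14 ↦ 0x7239045618 ∷ []) ∷
  entry 53 (52 ∷ 11 ∷ 9 ∷ 1 ∷ 1 ∷ 1 ∷ 0 ∷ []) (dominated 7 0)
    (21 ↦ 0x845670 ∷ 0 ↦ 0x876543210 ∷ 13 ↦ 0x82160354 ∷ []) ∷
  entry 174 (124 ∷ 52 ∷ 11 ∷ 9 ∷ 1 ∷ 1 ∷ 1 ∷ 0 ∷ []) (irreducible 3)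
    (12 ↦ 0x987650 ∷ 23 ↦ 0x283109 ∷ 23 ↦ 0x459301 ∷ 16 ↦ 0x8765901342 ∷ 23 ↦ 0x789502 ∷
    23 ↦ 0x950781 ∷ 22 ↦ 0x789560 ∷ 23 ↦ 0x876502 ∷ 23 ↦ 0x825130 ∷ 22 ↦ 0x876590 ∷
    23 ↦ 0x920418 ∷ 23 ↦ 0x895602 ∷ 22 ↦ 0x895670 ∷ 23 ↦ 0x980653 ∷ 22 ↦ 0x629140 ∷
    16 ↦ 0x7039245618 ∷ 23 ↦ 0x930721 ∷ 23 ↦ 0x987602 ∷ 23 ↦ 0x890642 ∷ 22 ↦ 0x987650 ∷
    23 ↦ 0x926410 ∷ 23 ↦ 0x956702 ∷ 23 ↦ 0x907632 ∷ 22 ↦ 0x956780 ∷ 22 ↦ 0x926410 ∷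
    16 ↦ 0x8315206749 ∷ 23 ↦ 0x956780 ∷ 22 ↦ 0x825130 ∷ 23 ↦ 0x895670 ∷ 23 ↦ 0x904635 ∷
    23 ↦ 0x987650 ∷ 22 ↦ 0x914620 ∷ []) ∷
  entry 124 (52 ∷ 11 ∷ 9 ∷ 1 ∷ 1 ∷ 1 ∷ 0 ∷ []) (dominated 2 0)
    (24 ↦ 0x845601 ∷ 0 ↦ 0x876543210 ∷ 15 ↦ 0x60341287 ∷ 24 ↦ 0x803524 ∷ 24 ↦ 0x876540 ∷ []) ∷
  entry 52 (11 ∷ 9 ∷ 1 ∷ 1 ∷ 1 ∷ 0 ∷ []) (dominated 4 1)
    (24 ↦ 0x650372 ∷ 2 ↦ 0x76543210 ∷ 25 ↦ 0x654370 ∷ 25 ↦ 0x734560 ∷ 0 ↦ 0x76543210 ∷ []) ∷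
  entry 86 (62 ∷ 11 ∷ 9 ∷ 1 ∷ 1 ∷ 1 ∷ 0 ∷ []) (irreducible 3)
    (15 ↦ 0x876540 ∷ 26 ↦ 0x253104 ∷ 26 ↦ 0x318204 ∷ 17 ↦ 0x87654031 ∷ 26 ↦ 0x678402 ∷
    26 ↦ 0x840671 ∷ 25 ↦ 0x678450 ∷ 26 ↦ 0x765402 ∷ 25 ↦ 0x765480 ∷ 26 ↦ 0x820317 ∷
    26 ↦ 0x784502 ∷ 25 ↦ 0x784560 ∷ 26 ↦ 0x705483 ∷ 25 ↦ 0x528130 ∷ 17 ↦ 0x81352067 ∷
    26 ↦ 0x765480 ∷ 26 ↦ 0x876502 ∷ 26 ↦ 0x780532 ∷ 26 ↦ 0x825310 ∷ 25 ↦ 0x876540 ∷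
    26 ↦ 0x845602 ∷ 25 ↦ 0x845670 ∷ 26 ↦ 0x608451 ∷ 25 ↦ 0x825310 ∷ 2 ↦ 0x567841023 ∷
    26 ↦ 0x845670 ∷ 2 ↦ 0x876543021 ∷ 26 ↦ 0x784560 ∷ 26 ↦ 0x678450 ∷ 26 ↦ 0x876540 ∷
    25 ↦ 0x813520 ∷ []) ∷
  entry 62 (11 ∷ 9 ∷ 1 ∷ 1 ∷ 1 ∷ 0 ∷ []) (dominated 1 0)
    (27 ↦ 0x734501 ∷ 0 ↦ 0x76543210 ∷ 0 ↦ 0x56734210 ∷ 27 ↦ 0x567340 ∷ 27 ↦ 0x765430 ∷ []) ∷
  entry 11 (9 ∷ 1 ∷ 1 ∷ 1 ∷ 0 ∷ []) (dominated 5 0)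
    (27 ↦ 0x654320 ∷ 28 ↦ 0x623450 ∷ 2 ↦ 0x6543210 ∷ 28 ↦ 0x562340 ∷ 0 ↦ 0x6543210 ∷ []) ∷
  entry 62 (31 ∷ 9 ∷ 1 ∷ 1 ∷ 1 ∷ 0 ∷ []) (dominated 1 0)
    (18 ↦ 0x765430 ∷ 29 ↦ 0x567301 ∷ 29 ↦ 0x654301 ∷ 29 ↦ 0x673401 ∷ 29 ↦ 0x765401 ∷
    29 ↦ 0x734501 ∷ []) ∷
  entry 31 (9 ∷ 1 ∷ 1 ∷ 1 ∷ 0 ∷ []) (irreducible 3)
    (19 ↦ 0x654320 ∷ 19 ↦ 0x654320 ∷ 30 ↦ 0x456201 ∷ 29 ↦ 0x456230 ∷ 30 ↦ 0x543201 ∷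
    29 ↦ 0x543260 ∷ 30 ↦ 0x562301 ∷ 29 ↦ 0x562340 ∷ 2 ↦ 0x6543201 ∷ 2 ↦ 0x6234501 ∷
    30 ↦ 0x543260 ∷ 30 ↦ 0x654301 ∷ 29 ↦ 0x654320 ∷ 30 ↦ 0x623401 ∷ 29 ↦ 0x623450 ∷
    2 ↦ 0x5432601 ∷ 2 ↦ 0x5623401 ∷ 30 ↦ 0x623450 ∷ 2 ↦ 0x4326501 ∷ 30 ↦ 0x562340 ∷
    30 ↦ 0x456230 ∷ 30 ↦ 0x654320 ∷ 0 ↦ 0x6543210 ∷ []) ∷
  entry 9 (1 ∷ 1 ∷ 1 ∷ 0 ∷ []) (irreducible 2)
    (20 ↦ 0x543210 ∷ 30 ↦ 0x345120 ∷ 30 ↦ 0x432150 ∷ 30 ↦ 0x451230 ∷ 2 ↦ 0x543210 ∷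
    2 ↦ 0x512340 ∷ 31 ↦ 0x432150 ∷ 30 ↦ 0x543210 ∷ 30 ↦ 0x512340 ∷ 2 ↦ 0x432150 ∷ 2 ↦ 0x451230 ∷
    31 ↦ 0x512340 ∷ 2 ↦ 0x321540 ∷ 31 ↦ 0x451230 ∷ 31 ↦ 0x345120 ∷ 31 ↦ 0x543210 ∷
    0 ↦ 0x543210 ∷ []) ∷
  []

withC₅ two =
  entry 0 (9 ∷ 1 ∷ 1 ∷ 1 ∷ 0 ∷ []) (dominated 0 5)
    (0 ↦ 0x623450 ∷ 0 ↦ 0x654320 ∷ 1 ↦ 0x543260 ∷ []) ∷
  entry 5 (9 ∷ 1 ∷ 1 ∷ 1 ∷ 0 ∷ []) (dominated 2 0)
    (1 ↦ 0x623450 ∷ 2 ↦ 0x543260 ∷ 1 ↦ 0x604123 ∷ 2 ↦ 0x623450 ∷ 2 ↦ 0x456210 ∷ []) ∷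
  entry 62 (31 ∷ 9 ∷ 1 ∷ 1 ∷ 1 ∷ 0 ∷ []) (dominated 1 0)
    (1 ↦ 0x765430 ∷ 3 ↦ 0x567301 ∷ 3 ↦ 0x654301 ∷ 3 ↦ 0x673401 ∷ 3 ↦ 0x765401 ∷
    3 ↦ 0x734501 ∷ []) ∷
  entry 31 (9 ∷ 1 ∷ 1 ∷ 1 ∷ 0 ∷ []) (irreducible 3)
    (2 ↦ 0x654320 ∷ 2 ↦ 0x654320 ∷ 4 ↦ 0x456201 ∷ 1 ↦ 0x654320 ∷ 4 ↦ 0x543201 ∷ 1 ↦ 0x432650 ∷
    4 ↦ 0x562301 ∷ 1 ↦ 0x623450 ∷ 3 ↦ 0x623450 ∷ 3 ↦ 0x654320 ∷ 4 ↦ 0x543260 ∷ 4 ↦ 0x654301 ∷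
    1 ↦ 0x543260 ∷ 4 ↦ 0x623401 ∷ 1 ↦ 0x326540 ∷ 3 ↦ 0x562340 ∷ 3 ↦ 0x543260 ∷ 4 ↦ 0x623450 ∷
    3 ↦ 0x456230 ∷ 4 ↦ 0x562340 ∷ 4 ↦ 0x456230 ∷ 4 ↦ 0x654320 ∷ 0 ↦ 0x6543210 ∷ []) ∷
  entry 9 (1 ∷ 1 ∷ 1 ∷ 0 ∷ []) (irreducible 2)
    (3 ↦ 0x543210 ∷ 2 ↦ 0x543210 ∷ 2 ↦ 0x321540 ∷ 2 ↦ 0x512340 ∷ 4 ↦ 0x512340 ∷ 4 ↦ 0x543210 ∷
    5 ↦ 0x432150 ∷ 2 ↦ 0x432150 ∷ 2 ↦ 0x215430 ∷ 4 ↦ 0x451230 ∷ 4 ↦ 0x432150 ∷ 5 ↦ 0x512340 ∷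
    4 ↦ 0x345120 ∷ 5 ↦ 0x451230 ∷ 5 ↦ 0x345120 ∷ 5 ↦ 0x543210 ∷ 0 ↦ 0x543210 ∷ []) ∷
  []

-- The search from a single vertex, its last entry. The 5-cycle is a leaf here, being resolved
-- beforehand.
withoutC₅ : List Entry
withoutC₅ =
  entry 31 (0 ∷ 26 ∷ 14 ∷ 3 ∷ 2 ∷ 0 ∷ 0 ∷ []) (dominated 7 0)
    (0 ↦ 0x86120 ∷ 0 ↦ 0x84150 ∷ []) ∷
  entry 0 (26 ∷ 14 ∷ 3 ∷ 2 ∷ 0 ∷ 0 ∷ []) (dominated 0 6)
    (0 ↦ 0x76543210 ∷ 0 ↦ 0x74365210 ∷ []) ∷
  entry 231 (622 ∷ 486 ∷ 230 ∷ 54 ∷ 7 ∷ 26 ∷ 14 ∷ 3 ∷ 2 ∷ 0 ∷ 0 ∷ []) (dominated 5 0)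
    (2 ↦ 0xc3b02 ∷ 2 ↦ 0xa8170 ∷ 2 ↦ 0xc8b90 ∷ 2 ↦ 0x53140 ∷ []) ∷
  entry 622 (486 ∷ 230 ∷ 54 ∷ 7 ∷ 26 ∷ 14 ∷ 3 ∷ 2 ∷ 0 ∷ 0 ∷ []) (irreducible 3)
    (1 ↦ 0xba98760 ∷ 3 ↦ 0xa3102 ∷ 3 ↦ 0x98607 ∷ 3 ↦ 0x98607 ∷ 3 ↦ 0xb7086 ∷ 3 ↦ 0xb7086 ∷
    3 ↦ 0xb7086 ∷ 3 ↦ 0x42031 ∷ 0 ↦ 0xba9876543210 ∷ 0 ↦ 0x95b678a12340 ∷ 3 ↦ 0xa7906 ∷
    3 ↦ 0xa3102 ∷ 0 ↦ 0x548967ba1230 ∷ 3 ↦ 0xb90a6 ∷ 3 ↦ 0xb2a01 ∷ 3 ↦ 0x97560 ∷ 3 ↦ 0xb2a01 ∷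
    0 ↦ 0x4375968ba120 ∷ 0 ↦ 0xb83a12459670 ∷ 3 ↦ 0xb7a80 ∷ 3 ↦ 0xb7a80 ∷ 3 ↦ 0xb7a80 ∷
    3 ↦ 0x53042 ∷ 0 ↦ 0xa16b87954320 ∷ 0 ↦ 0x9625431ab870 ∷ 3 ↦ 0xb98a0 ∷ 3 ↦ 0x94053 ∷
    0 ↦ 0x219345678ba0 ∷ 3 ↦ 0xb18a0 ∷ 3 ↦ 0x94650 ∷ 3 ↦ 0xb18a0 ∷ 0 ↦ 0x32645978ba10 ∷
    0 ↦ 0x872ba1345960 ∷ 0 ↦ 0x7618ba234590 ∷ []) ∷
  entry 486 (230 ∷ 54 ∷ 7 ∷ 26 ∷ 14 ∷ 3 ∷ 2 ∷ 0 ∷ 0 ∷ []) (dominated 5 0)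
    (4 ↦ 0xa6075 ∷ 4 ↦ 0x42031 ∷ 0 ↦ 0xa9876543210 ∷ []) ∷
  entry 230 (54 ∷ 7 ∷ 26 ∷ 14 ∷ 3 ∷ 2 ∷ 0 ∷ 0 ∷ []) (dominated 5 0)
    (5 ↦ 0x95860 ∷ 5 ↦ 0x72031 ∷ 0 ↦ 0x9876543210 ∷ []) ∷
  entry 54 (7 ∷ 26 ∷ 14 ∷ 3 ∷ 2 ∷ 0 ∷ 0 ∷ []) (dominated 7 0)
    (6 ↦ 0x86170 ∷ 6 ↦ 0x61320 ∷ 0 ↦ 0x876543210 ∷ []) ∷
  entry 7 (26 ∷ 14 ∷ 3 ∷ 2 ∷ 0 ∷ 0 ∷ []) (dominated 5 0)
    (7 ↦ 0x53120 ∷ 0 ↦ 0x76543210 ∷ 7 ↦ 0x73140 ∷ 0 ↦ 0x56723410 ∷ []) ∷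
  entry 109 (78 ∷ 15 ∷ 26 ∷ 14 ∷ 3 ∷ 2 ∷ 0 ∷ 0 ∷ []) (dominated 8 0)
    (8 ↦ 0x97680 ∷ 3 ↦ 0x6549870132 ∷ []) ∷
  entry 78 (15 ∷ 26 ∷ 14 ∷ 3 ∷ 2 ∷ 0 ∷ 0 ∷ []) (dominated 6 1)
    (9 ↦ 0x86073 ∷ 3 ↦ 0x854763021 ∷ 0 ↦ 0x876543210 ∷ 9 ↦ 0x86073 ∷ 9 ↦ 0x84250 ∷ []) ∷
  entry 15 (26 ∷ 14 ∷ 3 ∷ 2 ∷ 0 ∷ 0 ∷ []) (dominated 6 0)
    (10 ↦ 0x73640 ∷ 3 ↦ 0x65274301 ∷ 0 ↦ 0x76543210 ∷ 10 ↦ 0x73640 ∷ 10 ↦ 0x73140 ∷ []) ∷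
  -- The triangular prism, which is the complement of the 6-cycle.
  entry 26 (14 ∷ 3 ∷ 2 ∷ 0 ∷ 0 ∷ []) (irreducible 2)
    (9 ↦ 0x6543210 ∷ 11 ↦ 0x43102 ∷ 11 ↦ 0x62031 ∷ 3 ↦ 0x6543210 ∷ 11 ↦ 0x52401 ∷
    3 ↦ 0x5634120 ∷ 0 ↦ 0x6543210 ∷ 11 ↦ 0x64051 ∷ 3 ↦ 0x6325410 ∷ 0 ↦ 0x6325410 ∷
    11 ↦ 0x64051 ∷ 11 ↦ 0x62530 ∷ 3 ↦ 0x5416320 ∷ 0 ↦ 0x5416320 ∷ 11 ↦ 0x62530 ∷ 11 ↦ 0x64350 ∷
    11 ↦ 0x64350 ∷ 3 ↦ 0x4125630 ∷ 0 ↦ 0x4125630 ∷ 3 ↦ 0x3216540 ∷ 0 ↦ 0x3216540 ∷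
    0 ↦ 0x2143650 ∷ []) ∷
  entry 0 (60 ∷ 27 ∷ 14 ∷ 3 ∷ 2 ∷ 0 ∷ 0 ∷ []) (dominated 0 7) [] ∷
  entry 15 (60 ∷ 27 ∷ 14 ∷ 3 ∷ 2 ∷ 0 ∷ 0 ∷ []) (dominated 6 0)
    (13 ↦ 0x62130 ∷ 4 ↦ 0x104632857 ∷ 13 ↦ 0x84150 ∷ 4 ↦ 0x102854637 ∷ []) ∷
  -- The complement of the 7-cycle.
  entry 60 (27 ∷ 14 ∷ 3 ∷ 2 ∷ 0 ∷ 0 ∷ []) (irreducible 3)
    (1 ↦ 0x76543210 ∷ 14 ↦ 0x53201 ∷ 14 ↦ 0x42301 ∷ 4 ↦ 0x50421367 ∷ 14 ↦ 0x73041 ∷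
    4 ↦ 0x70243165 ∷ 0 ↦ 0x76543210 ∷ 14 ↦ 0x62051 ∷ 4 ↦ 0x60352174 ∷ 0 ↦ 0x67452310 ∷
    14 ↦ 0x73041 ∷ 14 ↦ 0x75062 ∷ 4 ↦ 0x70165243 ∷ 0 ↦ 0x74365120 ∷ 14 ↦ 0x75062 ∷
    14 ↦ 0x75062 ∷ 14 ↦ 0x73640 ∷ 14 ↦ 0x73640 ∷ 4 ↦ 0x60174352 ∷ 0 ↦ 0x65274130 ∷
    14 ↦ 0x73640 ∷ 14 ↦ 0x75460 ∷ 14 ↦ 0x75460 ∷ 14 ↦ 0x75460 ∷ 4 ↦ 0x50367421 ∷
    0 ↦ 0x52167340 ∷ 4 ↦ 0x40276531 ∷ 0 ↦ 0x43176250 ∷ 0 ↦ 0x31247560 ∷ []) ∷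
  entry 27 (14 ∷ 3 ∷ 2 ∷ 0 ∷ 0 ∷ []) (dominated 3 0)
    (15 ↦ 0x64051 ∷ 15 ↦ 0x64051 ∷ 15 ↦ 0x64051 ∷ 4 ↦ 0x3016542 ∷ 0 ↦ 0x6543210 ∷ []) ∷
  entry 14 (3 ∷ 2 ∷ 0 ∷ 0 ∷ []) (dominated 3 2)
    (16 ↦ 0x53240 ∷ 16 ↦ 0x53240 ∷ 4 ↦ 0x543210 ∷ 0 ↦ 0x543210 ∷ []) ∷
  entry 3 (2 ∷ 0 ∷ 0 ∷ []) (dominated 3 0)
    (17 ↦ 0x42130 ∷ 0 ↦ 0x43210 ∷ []) ∷
  entry 2 (0 ∷ 0 ∷ []) (dominated 1 2)
    (0 ↦ 0x3210 ∷ []) ∷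
  entry 0 (0 ∷ []) (dominated 1 0)
    (0 ↦ 0x210 ∷ []) ∷
  entry 3 (1 ∷ 0 ∷ []) (irreducible 2)
    (1 ↦ 0x302 ∷ 1 ↦ 0x302 ∷ 1 ↦ 0x301 ∷ 0 ↦ 0x30 ∷ 1 ↦ 0x201 ∷ 0 ↦ 0x20 ∷ 0 ↦ 0x10 ∷ []) ∷
  entry 1 (0 ∷ []) (irreducible 1)
    (2 ↦ 0x201 ∷ 1 ↦ 0x20 ∷ 1 ↦ 0x10 ∷ 0 ↦ 0x210 ∷ []) ∷
  entry 0 [] (irreducible 0)
    (2 ↦ 0x10 ∷ 0 ↦ 0x10 ∷ []) ∷
  []

-- Evaluation of the checks, and the conclusion.

forbidden : HIndex → Environment
forbidden c = map (λ i → _ , patternOf (H i)) (others c)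

c₅ : ∃ Pattern
c₅ = _ , decode (9 ∷ 1 ∷ 1 ∷ 1 ∷ 0 ∷ [])

withC₅-verified : ∀ c → verifyAll (forbidden c) (withC₅ c) ≡ true
withC₅-verified two   = refl
withC₅-verified three = refl
withC₅-verified four  = refl

withoutC₅-verified : verifyAll (c₅ ∷ []) withoutC₅ ≡ true
withoutC₅-verified = refl

remaining : ∀ a b → a ≢ b → ∃ λ c → All (λ i → i ≡ a ⊎ i ≡ b) (others c)
remaining two   two   a≢b = ⊥-elim (a≢b refl)
remaining two   three _   = four  , inj₁ refl ∷ inj₂ refl ∷ []
remaining two   four  _   = three , inj₁ refl ∷ inj₂ refl ∷ []
remaining three two   _   = four  , inj₂ refl ∷ inj₁ refl ∷ []
remaining three three a≢b = ⊥-elim (a≢b refl)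
remaining three four  _   = two   , inj₁ refl ∷ inj₂ refl ∷ []
remaining four  two   _   = three , inj₂ refl ∷ inj₁ refl ∷ []
remaining four  three _   = two   , inj₂ refl ∷ inj₁ refl ∷ []
remaining four  four  a≢b = ⊥-elim (a≢b refl)

-- The first search resolves the 5-cycle; with its help the second one resolves a single vertex, and
-- this embeds into every nonempty `U`.
irreducible⇒extendable : ∀ (G : Graph) c → ¬ InducedCopy 2K₂ G → ¬ InducedCopy (K 4) G →
  All (λ i → ¬ InducedCopy (H i) G) (others c) →
  ∀ U → Recolouring.Irreducible G U → Recolouring.Extendable G U
irreducible⇒extendable G c ¬2K₂ ¬K₄ ¬H []        irr k (h , ch) _ _ = h , ch , λ ()
irreducible⇒extendable G c ¬2K₂ ¬K₄ ¬H U@(_ ∷ _) irr = K₁-resolved (singleton (here refl))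
  where
  open Soundness G ¬2K₂ ¬K₄ U irr
  verified⇒resolved : ∀ {env} es → All Resolved env → verifyAll env es ≡ true → All Resolved (extend env es)
  verified⇒resolved es done eq = verifyAll-sound _ es done (Equivalence.from T-≡ eq)

  forbidden-resolved : ∀ {is} → All (λ i → ¬ InducedCopy (H i) G) is →
    All Resolved (map (λ i → _ , patternOf (H i)) is)
  forbidden-resolved []                     = []
  forbidden-resolved {i ∷ _} (¬Hi ∷ ¬His) = free-resolved (H i) ¬Hi ∷ forbidden-resolved ¬His

  last-is-C₅ : ∀ c → ∃ λ env → extend (forbidden c) (withC₅ c) ≡ c₅ ∷ env
  last-is-C₅ two   = _ , refl
  last-is-C₅ three = _ , refl
  last-is-C₅ four  = _ , refl

  C₅-resolved : Resolved c₅
  C₅-resolved = All.head (subst (All Resolved) (proj₂ (last-is-C₅ c))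
    (verified⇒resolved (withC₅ c) (forbidden-resolved ¬H) (withC₅-verified c)))

  K₁-resolved : Resolved (_ , decode (0 ∷ []))
  K₁-resolved = All.head (verified⇒resolved withoutC₅ (C₅-resolved ∷ []) withoutC₅-verified)

theorem1p6 : (a b : HIndex) → a ≢ b →
    (G : Graph) → Free (2K₂ ∷ K 4 ∷ H a ∷ H b ∷ []) G → Recolorable G
theorem1p6 a b a≢b G (¬2K₂ ∷ ¬K₄ ∷ ¬Ha ∷ ¬Hb ∷ []) with c , covers ← remaining a b a≢b =
  Recolouring.recolorable G (irreducible⇒extendable G c ¬2K₂ ¬K₄
    (All.map [ (λ { refl → ¬Ha }) , (λ { refl → ¬Hb }) ]′ covers))
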